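{- Let $\dot G=(G,\sigma)$ be a signed $(0,2)$-graph with spectrum $\{[-\lambda]^m,[-\mu]^1,[\mu]^1,[\lambda]^m\}$, where $m\geqslant1$ and $1\leqslant\mu<\lambda$. Then $G$ is the complete graph $K_4$.
   Context: A signed graph $\dot G=(G,\sigma)$ consists of a simple graph $G$ and $\sigma:E(G)\to\{1,-1\}$; its adjacency matrix is that of $G$ with entries of negative edges replaced by $-1$, and its spectrum is the multiset of eigenvalues of this matrix. A signed $(0,2)$-graph is a connected signed graph in which any two distinct vertices have exactly $0$ or $2$ common neighbours. The notation $[\nu]^k$ means eigenvalue $\nu$ with multiplicity $k$. -}

module Defs where

open import Level using (Level; _⊔_) renaming (suc to lsuc)
open import Data.Nat using (ℕ; zero; suc)
open import Data.Integer using (ℤ; +_; -[1+_])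
open import Data.Fin using (Fin; zero; suc; punchIn)
open import Data.Bool using (Bool; true; false; if_then_else_)
open import Data.Product using (Σ; _×_; _,_)
open import Data.Sum using (_⊎_)
open import Relation.Binary.PropositionalEquality using (_≡_)
open import Relation.Binary.Structures using (IsStrictTotalOrder)
open import Relation.Nullary using (¬_; does)
open import Algebra.Bundles using (CommutativeRing)

-- A simple graph G on Fin n (symmetric, irreflexive adjacency) together
-- with a signature σ : E(G) → {1,-1}; 'neg i j ≡ true' means the edge ij
-- is negative (only meaningful when ij is an edge).
record SignedGraph (n : ℕ) : Set where
  field
    adj      : Fin n → Fin n → Bool
    adj-sym  : ∀ i j → adj i j ≡ adj j i
    adj-irr  : ∀ i → adj i i ≡ false
    neg      : Fin n → Fin n → Bool
    neg-sym  : ∀ i j → adj i j ≡ true → neg i j ≡ neg j i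

adjMatrix : ∀ {n} → SignedGraph n → Fin n → Fin n → ℤ
adjMatrix Gs i j =
  if SignedGraph.adj Gs i j
  then (if SignedGraph.neg Gs i j then -[1+ 0 ] else + 1)
  else + 0

countF : ∀ {n} → (Fin n → Bool) → ℕ
countF {zero}  p = zero
countF {suc n} p = (if p zero then 1 else 0) Data.Nat.+ countF (λ i → p (suc i))

commonNbrs : ∀ {n} → SignedGraph n → Fin n → Fin n → ℕ
commonNbrs Gs i j = countF (λ k → SignedGraph.adj Gs i k Data.Bool.∧ SignedGraph.adj Gs j k)

data Walk {n} (Gs : SignedGraph n) : Fin n → Fin n → Set where
  here : ∀ {i} → Walk Gs i i
  step : ∀ {i j k} → SignedGraph.adj Gs i j ≡ true → Walk Gs j k → Walk Gs i k

Connected : ∀ {n} → SignedGraph n → Set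
Connected Gs = ∀ i j → Walk Gs i j

Is02 : ∀ {n} → SignedGraph n → Set
Is02 Gs = Connected Gs ×
  (∀ i j → ¬ i ≡ j → commonNbrs Gs i j ≡ 0 ⊎ commonNbrs Gs i j ≡ 2)

IsK4 : ∀ {n} → SignedGraph n → Set
IsK4 {n} Gs = n ≡ 4 × (∀ i j → ¬ i ≡ j → SignedGraph.adj Gs i j ≡ true)

record OrderedField (c ℓ₁ ℓ₂ : Level) : Set (lsuc (c ⊔ ℓ₁ ⊔ ℓ₂)) where
  field
    commutativeRing : CommutativeRing c ℓ₁
  open CommutativeRing commutativeRing public
  field
    _<_                : Carrier → Carrier → Set ℓ₂
    isStrictTotalOrder : IsStrictTotalOrder _≈_ _<_
    +-mono-<           : ∀ {x y} z → x < y → (x + z) < (y + z)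
    *-pos              : ∀ {x y} → 0# < x → 0# < y → 0# < (x * y)
    0<1                : 0# < 1#
    inverse            : ∀ x → ¬ (x ≈ 0#) → Σ Carrier (λ y → (x * y) ≈ 1#)

  _≤_ : Carrier → Carrier → Set (ℓ₁ ⊔ ℓ₂)
  x ≤ y = x < y ⊎ x ≈ y

module _ {c ℓ₁ ℓ₂} (F : OrderedField c ℓ₁ ℓ₂) where
  open OrderedField F using (Carrier; _≈_; _+_; _*_; -_; _-_; 0#; 1#)

  ιℕ : ℕ → Carrier
  ιℕ zero    = 0#
  ιℕ (suc n) = 1# + ιℕ n

  ιℤ : ℤ → Carrier
  ιℤ (+ n)     = ιℕ n
  ιℤ -[1+ n ]  = - ιℕ (suc n)

  pow : Carrier → ℕ → Carrier
  pow x zero    = 1#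
  pow x (suc k) = x * pow x k

  sumF : ∀ {n} → (Fin n → Carrier) → Carrier
  sumF {zero}  f = 0#
  sumF {suc n} f = f zero + sumF (λ i → f (suc i))

  altSign : ℕ → Carrier → Carrier
  altSign zero    x = x
  altSign (suc k) x = - altSign k x

  det : ∀ {n} → (Fin n → Fin n → Carrier) → Carrier
  det {zero}  M = 1#
  det {suc n} M = sumF (λ j →
    altSign (Data.Fin.toℕ j) (M zero j * det (λ i k → M (suc i) (punchIn j k))))

  charPolyAt : ∀ {n} → (Fin n → Fin n → ℤ) → Carrier → Carrier
  charPolyAt {n} A x = det (λ i j →
    (if does (i Data.Fin.≟ j) then x else 0#) - ιℤ (A i j))

{-# OPTIONS --safe #-}

-- Writing P(t) = det(I - tA), Jacobi's formula and the adjugate give Newton's identities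
-- n P = t P' + P · ∑ tr(Aᵏ) tᵏ, so the characteristic polynomial yields n = 2m + 2 and all traces
-- tr(Aᵏ). These make X = (A² - λ²)(A² - μ²) orthogonal to itself, and X is symmetric over an
-- ordered field, so X = 0. Hence B = λ² - A² satisfies B² = θB with θ = λ² - μ² > 0 and is positive
-- semidefinite. The graph is regular of degree r; put d = λ² - r, the diagonal entry of B. The
-- off-diagonal entries of A² are 0 or ±2, so d < 2 would force them to vanish by semidefiniteness,
-- and then B = d I contradicts B² = θB. So d ≥ 2, and tr(A²) gives r = m d + μ² ≥ 2m + 1 = n - 1:
-- the graph is complete, and then n - 2 ∈ {0 , 2}.
module Submission where

open import Defs
open import Level using (Level)
open import Algebra.Bundles using (CommutativeRing)
open import Algebra.Solver.Ring.AlmostCommutativeRing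
  using (fromCommutativeRing; _-Raw-AlmostCommutative⟶_)
import Algebra.Solver.Ring
import Algebra.Properties.AbelianGroup
import Algebra.Properties.CommutativeMonoid.Mult
import Algebra.Properties.Ring
import Algebra.Properties.Semiring.Exp
import Algebra.Properties.Semiring.Mult
import Algebra.Properties.Semiring.Sum
import Relation.Binary.Reasoning.Setoid
open import Data.Bool using (Bool; true; false; if_then_else_; _∧_)
open import Data.Fin as Fin using (Fin; zero; suc; punchIn; pinch; toℕ)
open import Data.Integer as ℤ using (ℤ; +_; -[1+_])
import Data.Integer.Properties as ℤ
open import Data.Maybe using (Maybe; just; nothing)
open import Data.Nat as ℕ using (ℕ; zero; suc; s≤s; z≤n; _≥_)
import Data.Nat.Properties as ℕ
open import Data.Product using (∃; _×_; _,_; proj₁; proj₂)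
open import Data.Sum using (_⊎_; inj₁; inj₂)
open import Data.Vec.Functional using (updateAt)
open import Data.Vec.Functional.Properties
  using (updateAt-updates; updateAt-minimal; updateAt-commutes; map-updateAt; updateAt-id-local)
open import Function using (const; _∘_)
open import Relation.Binary using (tri<; tri≈; tri>; IsStrictTotalOrder)
open import Relation.Nullary using (¬_; Dec; yes; no; does; contradiction)
import Relation.Binary.PropositionalEquality as ≡
open ≡ using (_≡_; _≢_)

-- No eigenvector is available: the ordered field is arbitrary, and the spectrum is given only as an
-- identity between values of polynomial functions. Passing from values to coefficients uses that an
-- ordered field is infinite; the comparison of degrees there is what fixes n. I - tA is preferred
-- to xI - A because its determinant has constant term 1, hence cancels without division, and its
-- inverse is the explicit series ∑ Aᵏ tᵏ over any commutative ring. Symmetry stands in for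
-- diagonalisation: it turns tr(Aᵏ⁺ᵉ) into an inner product of two powers, and a vanishing sum of
-- squares has vanishing terms. Regularity is not part of the definition; it follows from counting
-- the walks of length three along an edge from either end. The contradiction for d < 2 needs a
-- second relation: B = d I only gives d = 0 or d = θ, while tr(A²) gives θ - d = m d, so that
-- either case makes θ vanish.

-- Ring solver with integer coefficients

module IntegerSolver {c ℓ} (R : CommutativeRing c ℓ) where
  open CommutativeRing R hiding (zero)
  open Algebra.Properties.Ring ring using (-‿distribˡ-*; -‿distribʳ-*; -0#≈0#)
  open Algebra.Properties.AbelianGroup +-abelianGroup using (⁻¹-involutive; ⁻¹-∙-comm)
  open Algebra.Properties.Semiring.Mult semiring using (×-homo-+; ×1-homo-*) renaming (_×_ to _×′_)
  open Relation.Binary.Reasoning.Setoid setoid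

  -- The solver has to compare coefficients, and an arbitrary commutative ring, such as a ring of
  -- power series, has no equality test; integers do.
  fromℤ : ℤ → Carrier
  fromℤ (+ n)    = n ×′ 1#
  fromℤ -[1+ n ] = - (suc n ×′ 1#)

  fromℤ-⊖ : ∀ m n → fromℤ (m ℤ.⊖ n) ≈ m ×′ 1# - n ×′ 1#
  fromℤ-⊖ m zero = trans (sym (+-identityʳ _)) (+-congˡ (sym -0#≈0#))
  fromℤ-⊖ zero (suc n) = sym (+-identityˡ _)
  fromℤ-⊖ (suc m) (suc n) = begin
    fromℤ (suc m ℤ.⊖ suc n)             ≡⟨ ≡.cong fromℤ (ℤ.[1+m]⊖[1+n]≡m⊖n m n) ⟩
    fromℤ (m ℤ.⊖ n)                     ≈⟨ fromℤ-⊖ m n ⟩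
    m ×′ 1# - n ×′ 1#                     ≈⟨ +-congʳ (+-identityˡ _) ⟨
    (0# + m ×′ 1#) - n ×′ 1#              ≈⟨ +-congʳ (+-congʳ (-‿inverseʳ 1#)) ⟨
    ((1# - 1#) + m ×′ 1#) - n ×′ 1#       ≈⟨ +-congʳ (+-congʳ (+-comm _ _)) ⟩
    ((- 1# + 1#) + m ×′ 1#) - n ×′ 1#     ≈⟨ +-congʳ (+-assoc _ _ _) ⟩
    (- 1# + suc m ×′ 1#) - n ×′ 1#        ≈⟨ +-congʳ (+-comm _ _) ⟩
    (suc m ×′ 1# - 1#) - n ×′ 1#          ≈⟨ +-assoc _ _ _ ⟩
    suc m ×′ 1# + (- 1# - n ×′ 1#)        ≈⟨ +-congˡ (⁻¹-∙-comm _ _) ⟩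
    suc m ×′ 1# - suc n ×′ 1#             ∎

  fromℤ-+ : ∀ i j → fromℤ (i ℤ.+ j) ≈ fromℤ i + fromℤ j
  fromℤ-+ (+ m)    (+ n)    = ×-homo-+ 1# m n
  fromℤ-+ (+ m)    -[1+ n ] = fromℤ-⊖ m (suc n)
  fromℤ-+ -[1+ m ] (+ n)    = trans (fromℤ-⊖ n (suc m)) (+-comm _ _)
  fromℤ-+ -[1+ m ] -[1+ n ] = begin
    - (suc (suc (m ℕ.+ n)) ×′ 1#)        ≡⟨ ≡.cong (λ k → fromℤ (ℤ.- (+ suc k))) (ℕ.+-suc m n) ⟨
    - ((suc m ℕ.+ suc n) ×′ 1#)          ≈⟨ -‿cong (×-homo-+ 1# (suc m) (suc n)) ⟩
    - (suc m ×′ 1# + suc n ×′ 1#)         ≈⟨ ⁻¹-∙-comm _ _ ⟨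
    - (suc m ×′ 1#) - suc n ×′ 1#         ∎

  fromℤ-neg : ∀ i → fromℤ (ℤ.- i) ≈ - fromℤ i
  fromℤ-neg (+ zero)  = sym -0#≈0#
  fromℤ-neg (+ suc n) = refl
  fromℤ-neg -[1+ n ]  = sym (⁻¹-involutive _)

  fromℤ-*⁺ : ∀ m j → fromℤ (+ m ℤ.* j) ≈ fromℤ (+ m) * fromℤ j
  fromℤ-*⁺ m (+ n) = trans (reflexive (≡.cong fromℤ (≡.sym (ℤ.pos-* m n)))) (×1-homo-* m n)
  fromℤ-*⁺ m -[1+ n ] = begin
    fromℤ (+ m ℤ.* -[1+ n ])             ≡⟨ ≡.cong fromℤ (ℤ.neg-distribʳ-* (+ m) (+ suc n)) ⟨
    fromℤ (ℤ.- (+ m ℤ.* + suc n))        ≈⟨ fromℤ-neg (+ m ℤ.* + suc n) ⟩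
    - fromℤ (+ m ℤ.* + suc n)            ≈⟨ -‿cong (fromℤ-*⁺ m (+ suc n)) ⟩
    - (m ×′ 1# * (suc n ×′ 1#))            ≈⟨ -‿distribʳ-* _ _ ⟩
    m ×′ 1# * - (suc n ×′ 1#)              ∎

  fromℤ-* : ∀ i j → fromℤ (i ℤ.* j) ≈ fromℤ i * fromℤ j
  fromℤ-* (+ m)    j = fromℤ-*⁺ m j
  fromℤ-* -[1+ m ] j = begin
    fromℤ (-[1+ m ] ℤ.* j)               ≡⟨ ≡.cong fromℤ (ℤ.neg-distribˡ-* (+ suc m) j) ⟨
    fromℤ (ℤ.- (+ suc m ℤ.* j))          ≈⟨ fromℤ-neg (+ suc m ℤ.* j) ⟩
    - fromℤ (+ suc m ℤ.* j)              ≈⟨ -‿cong (fromℤ-*⁺ (suc m) j) ⟩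
    - (suc m ×′ 1# * fromℤ j)             ≈⟨ -‿distribˡ-* _ _ ⟩
    - (suc m ×′ 1#) * fromℤ j             ∎

  fromℤ-morphism : ℤ.+-*-rawRing -Raw-AlmostCommutative⟶ fromCommutativeRing R
  fromℤ-morphism = record
    { ⟦_⟧    = fromℤ
    ; +-homo = fromℤ-+
    ; *-homo = fromℤ-*
    ; -‿homo = fromℤ-neg
    ; 0-homo = refl
    ; 1-homo = +-identityʳ 1#
    }

  fromℤ-≟ : ∀ i j → Maybe (fromℤ i ≈ fromℤ j)
  fromℤ-≟ i j with i ℤ.≟ j
  ... | yes i≡j = just (reflexive (≡.cong fromℤ i≡j))
  ... | no  _   = nothing

  open Algebra.Solver.Ring ℤ.+-*-rawRing (fromCommutativeRing R) fromℤ-morphism fromℤ-≟ public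
    using (solve; _:=_; _:+_; _:*_; _:-_; :-_; con)

-- Determinants over a commutative ring

infixl 8 _[_≔_]

_[_≔_] : ∀ {a} {X : Set a} {n} → (Fin n → X) → Fin n → X → Fin n → X
M [ i ≔ v ] = updateAt M i (const v)

-- An ordered pair of distinct columns is coded as (j , k), with second column `punchIn j k`. This
-- identifies the code of the exchanged pair.
punchIn-punchIn-pinch : ∀ {n} (j : Fin (suc n)) (k : Fin n) → punchIn (punchIn j k) (pinch k j) ≡ j
punchIn-punchIn-pinch {suc n} zero k       = ≡.refl
punchIn-punchIn-pinch (suc j) zero    = ≡.refl
punchIn-punchIn-pinch (suc j) (suc k) = ≡.cong suc (punchIn-punchIn-pinch j k)

-- Both orders of deleting the two columns leave the same columns in the same order.
punchIn-punchIn-swap : ∀ {n} (j : Fin (suc (suc n))) (k : Fin (suc n)) (l : Fin n) →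
  punchIn j (punchIn k l) ≡ punchIn (punchIn j k) (punchIn (pinch k j) l)
punchIn-punchIn-swap {n} zero    k l      = ≡.refl
punchIn-punchIn-swap (suc j) zero    l       = ≡.refl
punchIn-punchIn-swap (suc j) (suc k) zero    = ≡.refl
punchIn-punchIn-swap (suc j) (suc k) (suc l) = ≡.cong suc (punchIn-punchIn-swap j k l)

module Determinant {c ℓ} (R : CommutativeRing c ℓ) where
  open CommutativeRing R hiding (zero)
  open IntegerSolver R
  private module Σ = Algebra.Properties.Semiring.Sum semiring
  open Algebra.Properties.Ring ring
  open Relation.Binary.Reasoning.Setoid setoid

  -- Opaque, so that unification does not unfold sums over Fin (suc n).
  opaque
    sum : ∀ {n} → (Fin n → Carrier) → Carrier
    sum = Σ.sum

    sum-zero : ∀ (f : Fin 0 → Carrier) → sum f ≈ 0#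
    sum-zero f = refl

    sum-suc : ∀ {n} (f : Fin (suc n) → Carrier) → sum f ≈ f zero + sum (λ i → f (suc i))
    sum-suc f = refl

    sum-cong : ∀ {n} {f g : Fin n → Carrier} → (∀ i → f i ≈ g i) → sum f ≈ sum g
    sum-cong = Σ.sum-cong-≋

    sum-+ : ∀ {n} (f g : Fin n → Carrier) → sum (λ i → f i + g i) ≈ sum f + sum g
    sum-+ = Σ.∑-distrib-+

    sum-comm : ∀ {m n} (f : Fin m → Fin n → Carrier) →
      sum (λ i → sum (f i)) ≈ sum (λ j → sum (λ i → f i j))
    sum-comm = Σ.∑-comm

    *-sumˡ : ∀ {n} x (f : Fin n → Carrier) → x * sum f ≈ sum (λ i → x * f i)
    *-sumˡ = Σ.*-distribˡ-sum

    *-sumʳ : ∀ {n} x (f : Fin n → Carrier) → sum f * x ≈ sum (λ i → f i * x)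
    *-sumʳ = Σ.*-distribʳ-sum

    sum-0 : ∀ {n} {f : Fin n → Carrier} → (∀ i → f i ≈ 0#) → sum f ≈ 0#
    sum-0 {n} f≈0 = trans (sum-cong f≈0) (Σ.sum-replicate-zero n)

  sum-neg : ∀ {n} (f : Fin n → Carrier) → sum (λ i → - f i) ≈ - sum f
  sum-neg f = trans (sum-cong λ i → sym (-1*x≈-x (f i))) (trans (sym (*-sumˡ (- 1#) f)) (-1*x≈-x _))

  Matrix : ℕ → Set c
  Matrix n = Fin n → Fin n → Carrier

  sgn : ℕ → Carrier → Carrier
  sgn zero    x = x
  sgn (suc k) x = - sgn k x

  sgn-cong : ∀ k {x y} → x ≈ y → sgn k x ≈ sgn k y
  sgn-cong zero    x≈y = x≈y
  sgn-cong (suc k) x≈y = -‿cong (sgn-cong k x≈y)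

  sgn-neg : ∀ k x → sgn k (- x) ≈ - sgn k x
  sgn-neg zero    x = refl
  sgn-neg (suc k) x = -‿cong (sgn-neg k x)

  sgn-+ : ∀ k x y → sgn k (x + y) ≈ sgn k x + sgn k y
  sgn-+ zero    x y = refl
  sgn-+ (suc k) x y = trans (-‿cong (sgn-+ k x y))
    (solve 2 (λ x y → :- (x :+ y) := :- x :- y) refl _ _)

  sgn-* : ∀ k x y → sgn k (x * y) ≈ x * sgn k y
  sgn-* zero    x y = refl
  sgn-* (suc k) x y = trans (-‿cong (sgn-* k x y)) (-‿distribʳ-* _ _)

  sgn-0 : ∀ k {x} → x ≈ 0# → sgn k x ≈ 0#
  sgn-0 zero    x≈0 = x≈0
  sgn-0 (suc k) x≈0 = trans (-‿cong (sgn-0 k x≈0)) -0#≈0#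

  sgn-sum : ∀ k {n} (f : Fin n → Carrier) → sgn k (sum f) ≈ sum (λ i → sgn k (f i))
  sgn-sum k {zero}  f = trans (sgn-0 k (sum-zero f)) (sym (sum-zero _))
  sgn-sum k {suc n} f = trans (sgn-cong k (sum-suc f)) (trans (sgn-+ k _ _)
    (trans (+-congˡ (sgn-sum k (f ∘ suc))) (sym (sum-suc _))))

  -- The indices `punchIn j k` and `pinch k j` add up to j + k ± 1, so exchanging two columns flips
  -- the sign.
  sgn-swap : ∀ {n} (j : Fin (suc n)) (k : Fin n) x →
    sgn (toℕ j) (sgn (toℕ k) x) + sgn (toℕ (punchIn j k)) (sgn (toℕ (pinch k j)) x) ≈ 0#
  sgn-swap {suc n} zero    k    x = -‿inverseʳ _
  sgn-swap (suc j) zero    x = -‿inverseˡ _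
  sgn-swap (suc j) (suc k) x = begin
    - sgn (toℕ j) (- sgn (toℕ k) x) + - sgn (toℕ (punchIn j k)) (- sgn (toℕ (pinch k j)) x)
      ≈⟨ +-cong (-‿cong (sgn-neg (toℕ j) _)) (-‿cong (sgn-neg (toℕ (punchIn j k)) _)) ⟩
    - - sgn (toℕ j) (sgn (toℕ k) x) + - - sgn (toℕ (punchIn j k)) (sgn (toℕ (pinch k j)) x)
      ≈⟨ +-cong (-‿involutive _) (-‿involutive _) ⟩
    sgn (toℕ j) (sgn (toℕ k) x) + sgn (toℕ (punchIn j k)) (sgn (toℕ (pinch k j)) x)
      ≈⟨ sgn-swap j k x ⟩
    0# ∎

  -- The off-diagonal positions (j , punchIn j k) are paired by transposition,
  -- which in these coordinates is (j , k) ↦ (punchIn j k , pinch k j).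
  sum-antisymmetric : ∀ {n} (g : Fin (suc n) → Fin n → Carrier) →
    (∀ j k → g j k + g (punchIn j k) (pinch k j) ≈ 0#) →
    sum (λ j → sum (g j)) ≈ 0#
  sum-antisymmetric {zero}  g anti = sum-0 λ j → sum-zero (g j)
  sum-antisymmetric {suc n} g anti = begin
    sum (λ j → sum (g j))
      ≈⟨ trans (sum-suc _) (+-congˡ (sum-cong λ j → sum-suc (g (suc j)))) ⟩
    sum (g zero) + sum (λ j → g (suc j) zero + sum (λ k → g (suc j) (suc k)))
      ≈⟨ +-congˡ (sum-+ _ _) ⟩
    sum (g zero) + (sum (λ j → g (suc j) zero) + sum (λ j → sum (λ k → g (suc j) (suc k))))
      ≈⟨ +-congˡ (+-congˡ (sum-antisymmetric (λ j k → g (suc j) (suc k)) (λ j k → anti (suc j) (suc k)))) ⟩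
    sum (g zero) + (sum (λ j → g (suc j) zero) + 0#)
      ≈⟨ +-congˡ (+-identityʳ _) ⟩
    sum (g zero) + sum (λ j → g (suc j) zero)
      ≈⟨ sum-+ _ _ ⟨
    sum (λ k → g zero k + g (suc k) zero)
      ≈⟨ sum-0 (anti zero) ⟩
    0# ∎

  determinant : ∀ {n} → Matrix n → Carrier
  minor : ∀ {n} → Fin (suc n) → (Fin n → Fin (suc n) → Carrier) → Carrier

  determinant {zero}  M = 1#
  determinant {suc n} M = sum (λ j → sgn (toℕ j) (M zero j * minor j (M ∘ suc)))

  minor j Q = determinant (λ i → Q i ∘ punchIn j)

  det-cong : ∀ {n} {M N : Matrix n} → (∀ i j → M i j ≈ N i j) → determinant M ≈ determinant N
  det-cong {zero}  M≈N = refl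
  det-cong {suc n} M≈N = sum-cong λ j →
    sgn-cong (toℕ j) (*-cong (M≈N zero j) (det-cong λ i k → M≈N (suc i) (punchIn j k)))

  det-cong-≗ : ∀ {n} {M N : Matrix n} → (∀ i → M i ≡ N i) → determinant M ≈ determinant N
  det-cong-≗ M≡N = det-cong λ i j → reflexive (≡.cong (λ r → r j) (M≡N i))

  minor-replace : ∀ {n} j (Q : Fin n → Fin (suc n) → Carrier) i v →
    minor j (Q [ i ≔ v ]) ≈ determinant ((λ k → Q k ∘ punchIn j) [ i ≔ v ∘ punchIn j ])
  minor-replace j Q i v = det-cong-≗ (map-updateAt {f = _∘ punchIn j} (λ _ → ≡.refl) Q i)

  -- Additivity and homogeneity in one statement, so that a single induction yields zero rows and
  -- finite combinations of rows as special cases.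
  det-linear : ∀ {n} (M : Matrix n) i a u v →
    determinant (M [ i ≔ (λ k → a * u k + v k) ]) ≈ a * determinant (M [ i ≔ u ]) + determinant (M [ i ≔ v ])
  det-linear {suc n} M zero a u v = begin
    sum (λ j → sgn (toℕ j) ((a * u j + v j) * minor j (M ∘ suc)))
      ≈⟨ sum-cong (λ j → begin
           sgn (toℕ j) ((a * u j + v j) * minor j (M ∘ suc))
             ≈⟨ sgn-cong (toℕ j) (solve 4 (λ a u v m → (a :* u :+ v) :* m := a :* (u :* m) :+ v :* m) refl a (u j) (v j) _) ⟩
           sgn (toℕ j) (a * (u j * minor j (M ∘ suc)) + v j * minor j (M ∘ suc))
             ≈⟨ sgn-+ (toℕ j) _ _ ⟩
           sgn (toℕ j) (a * (u j * minor j (M ∘ suc))) + sgn (toℕ j) (v j * minor j (M ∘ suc))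
             ≈⟨ +-congʳ (sgn-* (toℕ j) a _) ⟩
           a * sgn (toℕ j) (u j * minor j (M ∘ suc)) + sgn (toℕ j) (v j * minor j (M ∘ suc)) ∎) ⟩
    sum (λ j → a * sgn (toℕ j) (u j * minor j (M ∘ suc)) + sgn (toℕ j) (v j * minor j (M ∘ suc)))
      ≈⟨ sum-+ _ _ ⟩
    sum (λ j → a * sgn (toℕ j) (u j * minor j (M ∘ suc))) + determinant (M [ zero ≔ v ])
      ≈⟨ +-congʳ (*-sumˡ a (λ j → sgn (toℕ j) (u j * minor j (M ∘ suc)))) ⟨
    a * determinant (M [ zero ≔ u ]) + determinant (M [ zero ≔ v ]) ∎
  det-linear {suc n} M (suc i) a u v = begin
    sum (λ j → sgn (toℕ j) (M zero j * minor j (M ∘ suc [ i ≔ (λ k → a * u k + v k) ])))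
      ≈⟨ sum-cong (λ j → begin
           sgn (toℕ j) (M zero j * minor j (M ∘ suc [ i ≔ (λ k → a * u k + v k) ]))
             ≈⟨ sgn-cong (toℕ j) (*-congˡ (trans (minor-replace j _ i _)
                  (trans (det-linear _ i a (u ∘ punchIn j) (v ∘ punchIn j))
                    (sym (+-cong (*-congˡ (minor-replace j _ i u)) (minor-replace j _ i v)))))) ⟩
           sgn (toℕ j) (M zero j * (a * m u j + m v j))
             ≈⟨ sgn-cong (toℕ j) (solve 4 (λ x a u v → x :* (a :* u :+ v) := a :* (x :* u) :+ x :* v) refl _ a _ _) ⟩
           sgn (toℕ j) (a * (M zero j * m u j) + M zero j * m v j)
             ≈⟨ sgn-+ (toℕ j) _ _ ⟩
           sgn (toℕ j) (a * (M zero j * m u j)) + sgn (toℕ j) (M zero j * m v j)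
             ≈⟨ +-congʳ (sgn-* (toℕ j) a _) ⟩
           a * sgn (toℕ j) (M zero j * m u j) + sgn (toℕ j) (M zero j * m v j) ∎) ⟩
    sum (λ j → a * sgn (toℕ j) (M zero j * m u j) + sgn (toℕ j) (M zero j * m v j))
      ≈⟨ sum-+ _ _ ⟩
    sum (λ j → a * sgn (toℕ j) (M zero j * m u j)) + determinant (M [ suc i ≔ v ])
      ≈⟨ +-congʳ (*-sumˡ a (λ j → sgn (toℕ j) (M zero j * m u j))) ⟨
    a * determinant (M [ suc i ≔ u ]) + determinant (M [ suc i ≔ v ]) ∎
    where
    m : (Fin (suc n) → Carrier) → Fin (suc n) → Carrier
    m w j = minor j (M ∘ suc [ i ≔ w ])

  row-cong : ∀ {n} (M : Matrix n) i {u v} → (∀ j → u j ≈ v j) → determinant (M [ i ≔ u ]) ≈ determinant (M [ i ≔ v ])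
  row-cong M i {u} {v} u≈v = det-cong (pointwise M i)
    where
    pointwise : ∀ {m} (Q : Fin m → Fin _ → Carrier) i k j → (Q [ i ≔ u ]) k j ≈ (Q [ i ≔ v ]) k j
    pointwise Q zero    zero    j = u≈v j
    pointwise Q zero    (suc k) j = refl
    pointwise Q (suc i) zero    j = refl
    pointwise Q (suc i) (suc k) j = pointwise (Q ∘ suc) i k j

  -- Writing the zero row as `- 1# * 0# + 0#`, linearity returns the determinant D as - D + D.
  det-zero-row : ∀ {n} (M : Matrix n) i → determinant (M [ i ≔ const 0# ]) ≈ 0#
  det-zero-row M i = begin
    determinant (M [ i ≔ const 0# ])
      ≈⟨ row-cong M i (λ _ → trans (sym (-‿inverseˡ 0#)) (+-congʳ (sym (-1*x≈-x 0#)))) ⟩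
    determinant (M [ i ≔ const (- 1# * 0# + 0#) ])
      ≈⟨ det-linear M i (- 1#) (const 0#) (const 0#) ⟩
    - 1# * determinant (M [ i ≔ const 0# ]) + determinant (M [ i ≔ const 0# ])
      ≈⟨ +-congʳ (-1*x≈-x _) ⟩
    - determinant (M [ i ≔ const 0# ]) + determinant (M [ i ≔ const 0# ])
      ≈⟨ -‿inverseˡ _ ⟩
    0# ∎

  det-row-sum : ∀ {n} (M : Matrix n) i {m} (a : Fin m → Carrier) (u : Fin m → Fin n → Carrier) →
    determinant (M [ i ≔ (λ k → sum (λ j → a j * u j k)) ]) ≈ sum (λ j → a j * determinant (M [ i ≔ u j ]))
  det-row-sum M i {zero}  a u = trans (row-cong M i λ k → sum-zero _)
    (trans (det-zero-row M i) (sym (sum-zero _)))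
  det-row-sum M i {suc m} a u = trans (row-cong M i λ k → sum-suc _)
    (trans (det-linear M i (a zero) (u zero) _)
      (trans (+-congˡ (det-row-sum M i (a ∘ suc) (u ∘ suc))) (sym (sum-suc _))))

  -- Expansion along both top rows gives a sum over ordered pairs of columns. For equal rows,
  -- exchanging the columns changes a summand only by its sign.
  det-equal-top-rows : ∀ {n} (M : Matrix (suc (suc n))) →
    (∀ j → M zero j ≈ M (suc zero) j) → determinant M ≈ 0#
  det-equal-top-rows M eq = trans (sum-cong expand) (sum-antisymmetric term anti)
    where
    Q : _ → _ → Carrier
    Q j k = determinant (λ i l → M (suc (suc i)) (punchIn j (punchIn k l)))
    term : _ → _ → Carrier
    term j k = sgn (toℕ j) (sgn (toℕ k) (M zero j * (M (suc zero) (punchIn j k) * Q j k)))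
    expand : ∀ j → sgn (toℕ j) (M zero j * minor j (M ∘ suc)) ≈ sum (term j)
    expand j = trans (sgn-cong (toℕ j) (trans (*-sumˡ _ _) (sum-cong λ k → sym (sgn-* (toℕ k) _ _))))
      (sgn-sum (toℕ j) _)
    anti : ∀ j k → term j k + term (punchIn j k) (pinch k j) ≈ 0#
    anti j k = trans (+-congˡ (sgn-cong (toℕ (punchIn j k)) (sgn-cong (toℕ (pinch k j)) swapped)))
      (sgn-swap j k _)
      where
      swapped : M zero (punchIn j k) * (M (suc zero) (punchIn (punchIn j k) (pinch k j)) * Q (punchIn j k) (pinch k j))
              ≈ M zero j * (M (suc zero) (punchIn j k) * Q j k)
      swapped = begin
        M zero (punchIn j k) * (M (suc zero) (punchIn (punchIn j k) (pinch k j)) * Q (punchIn j k) (pinch k j))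
          ≈⟨ *-cong (eq _) (*-cong (trans (reflexive (≡.cong (M (suc zero)) (punchIn-punchIn-pinch j k))) (sym (eq j)))
               (det-cong λ i l → reflexive (≡.cong (M (suc (suc i))) (≡.sym (punchIn-punchIn-swap j k l))))) ⟩
        M (suc zero) (punchIn j k) * (M zero j * Q j k)
          ≈⟨ solve 3 (λ x y z → x :* (y :* z) := y :* (x :* z)) refl _ _ _ ⟩
        M zero j * (M (suc zero) (punchIn j k) * Q j k) ∎

  Alternating : ℕ → Set _
  Alternating n = ∀ (M : Matrix n) i k → i ≢ k → (∀ j → M i j ≈ M k j) → determinant M ≈ 0#

  det-equal-top-row : ∀ {n} → Alternating n → ∀ (M : Matrix (suc n)) k →
    (∀ j → M zero j ≈ M (suc k) j) → determinant M ≈ 0#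
  det-equal-top-row alt M zero eq = det-equal-top-rows M eq
  -- With x the top row and w the row below it, rows 1 and k + 2 of d (w + x) (w + x)
  -- agree; expanding by linearity leaves only d w x.
  det-equal-top-row {suc n} alt M (suc k) eq = begin
    determinant M
      ≈⟨ det-cong (λ i j → sym (restore i j)) ⟩
    d w x
      ≈⟨ +-identityˡ _ ⟨
    0# + d w x
      ≈⟨ +-congʳ (bottom-equal w) ⟨
    d w w + d w x
      ≈⟨ +-congʳ (*-identityˡ _) ⟨
    1# * d w w + d w x
      ≈⟨ det-linear (M [ suc zero ≔ w ]) (suc (suc k)) 1# w x ⟨
    d w y
      ≈⟨ +-identityʳ _ ⟨
    d w y + 0#
      ≈⟨ +-cong (sym (*-identityˡ _)) (sym (det-equal-top-rows (M [ suc zero ≔ x ] [ suc (suc k) ≔ y ]) (λ _ → refl))) ⟩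
    1# * d w y + d x y
      ≈⟨ +-cong (*-congˡ (commute w)) (commute x) ⟩
    1# * determinant (M [ suc (suc k) ≔ y ] [ suc zero ≔ w ]) + determinant (M [ suc (suc k) ≔ y ] [ suc zero ≔ x ])
      ≈⟨ det-linear (M [ suc (suc k) ≔ y ]) (suc zero) 1# w x ⟨
    determinant (M [ suc (suc k) ≔ y ] [ suc zero ≔ y ])
      ≈⟨ commute y ⟨
    d y y
      ≈⟨ bottom-equal y ⟩
    0# ∎
    where
    w x y : Fin (suc (suc n)) → Carrier
    w = M (suc zero)
    x = M zero
    y j = 1# * w j + x j
    d : (u v : Fin (suc (suc n)) → Carrier) → Carrier
    d u v = determinant (M [ suc zero ≔ u ] [ suc (suc k) ≔ v ])
    -- Both equal rows lie below the top one, so every minor of the top-row expansion contains them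
    -- and vanishes by the smaller case.
    bottom-equal : ∀ u → d u u ≈ 0#
    bottom-equal u = sum-0 λ j → sgn-0 (toℕ j) (trans (*-congˡ
      (alt (λ i → (M [ suc zero ≔ u ] [ suc (suc k) ≔ u ]) (suc i) ∘ punchIn j) zero (suc k) (λ ())
        (λ l → reflexive (≡.cong (λ r → r (punchIn j l))
          (≡.sym (updateAt-updates k {f = const u} (λ i → M (suc (suc i)))))))))
      (zeroʳ _))
    commute : ∀ u {v} → d u v ≈ determinant (M [ suc (suc k) ≔ v ] [ suc zero ≔ u ])
    commute u {v} = det-cong-≗ (updateAt-commutes (suc (suc k)) (suc zero) {f = const v} {g = const u} (λ ()) M)
    restore : ∀ i j → (M [ suc zero ≔ w ] [ suc (suc k) ≔ x ]) i j ≈ M i j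
    restore zero          j = refl
    restore (suc zero)    j = refl
    restore (suc (suc i)) j with k Fin.≟ i
    ... | yes ≡.refl = trans (reflexive (≡.cong (λ r → r j) (updateAt-updates k (λ i → M (suc (suc i)))))) (eq j)
    ... | no k≢i     = reflexive (≡.cong (λ r → r j) (updateAt-minimal i k (λ i → M (suc (suc i))) (k≢i ∘ ≡.sym)))

  -- Induction on the size: a pair below the top row persists in every minor, and a pair with the
  -- top row is reduced to the alternating property one size down.
  det-alternating : ∀ {n} → Alternating n
  det-alternating {suc n} M zero    zero    i≢k eq = contradiction ≡.refl i≢k
  det-alternating {suc n} M zero    (suc k) i≢k eq = det-equal-top-row det-alternating M k eq
  det-alternating {suc n} M (suc i) zero    i≢k eq = det-equal-top-row det-alternating M i (λ j → sym (eq j))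
  det-alternating {suc n} M (suc i) (suc k) i≢k eq = sum-0 λ j → sgn-0 (toℕ j)
    (trans (*-congˡ (det-alternating _ i k (i≢k ∘ ≡.cong suc) (eq ∘ punchIn j))) (zeroʳ (M zero j)))

  -- The identity matrix and the adjugate

  δ : ∀ {n} → Matrix n
  δ i j = if does (i Fin.≟ j) then 1# else 0#

  sum-δ : ∀ {n} (f : Fin n → Carrier) k → sum (λ j → f j * δ j k) ≈ f k
  sum-δ f zero    = trans (sum-suc _) (trans (+-cong (*-identityʳ _) (sum-0 λ j → zeroʳ (f (suc j)))) (+-identityʳ _))
  sum-δ f (suc k) = trans (sum-suc _) (trans (+-cong (zeroʳ _) (sum-δ (f ∘ suc) k)) (+-identityˡ _))

  δ-sym : ∀ {n} (i j : Fin n) → δ i j ≈ δ j i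
  δ-sym zero    zero    = refl
  δ-sym zero    (suc j) = refl
  δ-sym (suc i) zero    = refl
  δ-sym (suc i) (suc j) = δ-sym i j

  sum-δˡ : ∀ {n} (f : Fin n → Carrier) k → sum (λ j → δ k j * f j) ≈ f k
  sum-δˡ f k = trans (sum-cong λ j → trans (*-comm _ _) (*-congˡ (δ-sym k j))) (sum-δ f k)

  -- The cofactor is encoded by putting a unit row in place of row i; Cramer's rule then needs only
  -- row linearity and alternation, not Laplace expansion along an arbitrary row.
  adjugate : ∀ {n} → Matrix n → Matrix n
  adjugate M j i = determinant (M [ i ≔ δ j ])

  det-replace : ∀ {n} (M : Matrix n) i v → determinant (M [ i ≔ v ]) ≈ sum (λ j → v j * adjugate M j i)
  det-replace M i v = trans (row-cong M i λ k → sym (sum-δ v k)) (det-row-sum M i v δ)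

  -- The sum is the determinant of M with row i overwritten by row k: M itself if k = i, and a
  -- matrix with two equal rows otherwise.
  adjugate-inverse : ∀ {n} (M : Matrix n) k i → sum (λ j → M k j * adjugate M j i) ≈ determinant M * δ k i
  adjugate-inverse M k i = trans (sym (det-replace M i (M k))) (lemma k)
    where
    lemma : ∀ k → determinant (M [ i ≔ M k ]) ≈ determinant M * δ k i
    lemma k with k Fin.≟ i
    ... | yes ≡.refl = trans (det-cong-≗ (updateAt-id-local k M ≡.refl)) (sym (*-identityʳ _))
    ... | no k≢i = trans
      (det-alternating _ k i k≢i λ j → reflexive (≡.cong (λ r → r j)
        (≡.trans (updateAt-minimal k i M k≢i) (≡.sym (updateAt-updates i M)))))
      (sym (zeroʳ _))

  -- Jacobi's formula for a derivation

  module Derivation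
    (E : Carrier → Carrier)
    (E-cong : ∀ {x y} → x ≈ y → E x ≈ E y)
    (E-+ : ∀ x y → E (x + y) ≈ E x + E y)
    (E-* : ∀ x y → E (x * y) ≈ E x * y + x * E y)
    where

    private
      double⇒0 : ∀ {x} → x ≈ x + x → x ≈ 0#
      double⇒0 {x} x≈x+x = +-identityˡ-unique x x (sym x≈x+x)

    E-0 : E 0# ≈ 0#
    E-0 = double⇒0 (trans (E-cong (sym (+-identityˡ 0#))) (E-+ 0# 0#))

    E-1 : E 1# ≈ 0#
    E-1 = double⇒0 (trans (E-cong (sym (*-identityˡ 1#))) (trans (E-* 1# 1#)
      (+-cong (*-identityʳ _) (*-identityˡ _))))

    E-neg : ∀ x → E (- x) ≈ - E x
    E-neg x = +-inverseʳ-unique (E x) (E (- x))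
      (trans (sym (E-+ x (- x))) (trans (E-cong (-‿inverseʳ x)) E-0))

    E-sgn : ∀ k x → E (sgn k x) ≈ sgn k (E x)
    E-sgn zero    x = refl
    E-sgn (suc k) x = trans (E-neg _) (-‿cong (E-sgn k x))

    E-sum : ∀ {n} (f : Fin n → Carrier) → E (sum f) ≈ sum (E ∘ f)
    E-sum {zero}  f = trans (E-cong (sum-zero f)) (trans E-0 (sym (sum-zero _)))
    E-sum {suc n} f = trans (E-cong (sum-suc f)) (trans (E-+ _ _)
      (trans (+-congˡ (E-sum (f ∘ suc))) (sym (sum-suc _))))

    -- By the product rule in the top-row expansion, differentiating the entries gives the summand
    -- of row zero, and differentiating the minors gives the others by induction.
    E-det : ∀ {n} (M : Matrix n) → E (determinant M) ≈ sum (λ i → determinant (M [ i ≔ E ∘ M i ]))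
    E-det {zero}  M = trans E-1 (sym (sum-zero _))
    E-det {suc n} M = begin
      E (determinant M)
        ≈⟨ E-sum _ ⟩
      sum (λ j → E (sgn (toℕ j) (M zero j * minor j (M ∘ suc))))
        ≈⟨ sum-cong (λ j → trans (E-sgn (toℕ j) _) (trans (sgn-cong (toℕ j) (E-* _ _)) (sgn-+ (toℕ j) _ _))) ⟩
      sum (λ j → sgn (toℕ j) (E (M zero j) * minor j (M ∘ suc)) + sgn (toℕ j) (M zero j * E (minor j (M ∘ suc))))
        ≈⟨ sum-+ _ _ ⟩
      determinant (M [ zero ≔ E ∘ M zero ]) + sum (λ j → sgn (toℕ j) (M zero j * E (minor j (M ∘ suc))))
        ≈⟨ +-congˡ (sum-cong λ j → trans
             (sgn-cong (toℕ j) (trans (*-congˡ (trans (E-det _) (sum-cong λ i → sym (minor-replace j (M ∘ suc) i _))))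
               (*-sumˡ _ _)))
             (sgn-sum (toℕ j) _)) ⟩
      determinant (M [ zero ≔ E ∘ M zero ]) + sum (λ j → sum (λ i → sgn (toℕ j) (M zero j * minor j (M ∘ suc [ i ≔ E ∘ M (suc i) ]))))
        ≈⟨ +-congˡ (sum-comm _) ⟩
      determinant (M [ zero ≔ E ∘ M zero ]) + sum (λ i → determinant (M [ suc i ≔ E ∘ M (suc i) ]))
        ≈⟨ sum-suc _ ⟨
      sum (λ i → determinant (M [ i ≔ E ∘ M i ])) ∎

-- Formal power series and Newton's identities

module PowerSeries {c ℓ} (R : CommutativeRing c ℓ) where
  open CommutativeRing R hiding (zero)
  open IntegerSolver R
  open Determinant R
  open Algebra.Properties.Semiring.Mult semiring using (×-congʳ; ×-comm-*) renaming (_×_ to _×′_)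
  open Algebra.Properties.CommutativeMonoid.Mult +-commutativeMonoid using (×-distrib-+)
  open Algebra.Properties.Ring ring using (-0#≈0#; +-cancelˡ)
  private module ≈-Reasoning = Relation.Binary.Reasoning.Setoid setoid

  Series : Set c
  Series = ℕ → Carrier

  infix 4 _≋_
  -- A record keeps the two series visible in the type of an equality, where a bare pointwise
  -- statement would leave unification to guess them.
  record _≋_ (f g : Series) : Set ℓ where
    constructor coeffs
    field coeff : ∀ k → f k ≈ g k
  open _≋_ public

  tail : Series → Series
  tail f k = f (suc k)

  infixl 7 _·_
  infixl 6 _⊕_
  -- Convolution through f = `f 0` + t · `tail f`: no sum over the splittings of k appears, and the
  -- ring laws follow by induction on k.
  _⊕_ _·_ : Series → Series → Series
  (f ⊕ g) k = f k + g k
  (f · g) zero    = f 0 * g 0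
  (f · g) (suc k) = f 0 * g (suc k) + (tail f · g) k

  ⊖_ : Series → Series
  (⊖ f) k = - f k

  constant : Carrier → Series
  constant x zero    = x
  constant x (suc k) = 0#

  ·-zeroˡ : ∀ {f} g → (∀ k → f k ≈ 0#) → ∀ k → (f · g) k ≈ 0#
  ·-zeroˡ g f≈0 zero    = trans (*-congʳ (f≈0 0)) (zeroˡ _)
  ·-zeroˡ g f≈0 (suc k) = trans (+-cong (trans (*-congʳ (f≈0 0)) (zeroˡ _)) (·-zeroˡ g (f≈0 ∘ suc) k)) (+-identityˡ _)

  ·-constant : ∀ {f} g → (∀ k → f (suc k) ≈ 0#) → ∀ k → (f · g) k ≈ f 0 * g k
  ·-constant g f≈c zero    = refl
  ·-constant g f≈c (suc k) = trans (+-congˡ (·-zeroˡ g f≈c k)) (+-identityʳ _)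

  ·-cong : ∀ {f f′ g g′} → (∀ k → f k ≈ f′ k) → (∀ k → g k ≈ g′ k) → ∀ k → (f · g) k ≈ (f′ · g′) k
  ·-cong p q zero    = *-cong (p 0) (q 0)
  ·-cong p q (suc k) = +-cong (*-cong (p 0) (q (suc k))) (·-cong (p ∘ suc) q k)

  ·-distribʳ : ∀ h f g k → ((f ⊕ g) · h) k ≈ (f · h) k + (g · h) k
  ·-distribʳ h f g zero    = distribʳ _ _ _
  ·-distribʳ h f g (suc k) = trans (+-congˡ (·-distribʳ h (tail f) (tail g) k))
    (solve 5 (λ a b c p q → (a :+ b) :* c :+ (p :+ q) := (a :* c :+ p) :+ (b :* c :+ q)) refl _ _ _ _ _)

  ·-scaleˡ : ∀ x f g k → ((λ j → x * f j) · g) k ≈ x * (f · g) k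
  ·-scaleˡ x f g zero    = *-assoc _ _ _
  ·-scaleˡ x f g (suc k) = trans (+-congˡ (·-scaleˡ x (tail f) g k))
    (solve 4 (λ x a b p → x :* a :* b :+ x :* p := x :* (a :* b :+ p)) refl _ _ _ _)

  -- The mirror image of the defining recursion; commutativity amounts to the agreement of the two.
  ·-sucʳ : ∀ f g k → (f · g) (suc k) ≈ f (suc k) * g 0 + (f · tail g) k
  ·-sucʳ f g zero    = +-comm _ _
  ·-sucʳ f g (suc k) = trans (+-congˡ (·-sucʳ (tail f) g k))
    (solve 3 (λ a b p → a :+ (b :+ p) := b :+ (a :+ p)) refl _ _ _)

  ·-comm : ∀ f g k → (f · g) k ≈ (g · f) k
  ·-comm f g zero    = *-comm _ _
  ·-comm f g (suc k) = trans (+-cong (*-comm _ _) (·-comm (tail f) g k)) (sym (·-sucʳ g f k))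

  ·-assoc : ∀ f g h k → ((f · g) · h) k ≈ (f · (g · h)) k
  ·-assoc f g h zero    = *-assoc _ _ _
  ·-assoc f g h (suc k) = let open ≈-Reasoning in begin
    f 0 * g 0 * h (suc k) + (((λ j → f 0 * g (suc j)) ⊕ (tail f · g)) · h) k
      ≈⟨ +-congˡ (trans (·-distribʳ h _ _ k) (+-cong (·-scaleˡ (f 0) (tail g) h k) (·-assoc (tail f) g h k))) ⟩
    f 0 * g 0 * h (suc k) + (f 0 * (tail g · h) k + (tail f · (g · h)) k)
      ≈⟨ solve 5 (λ a b c p q → a :* b :* c :+ (a :* p :+ q) := a :* (b :* c :+ p) :+ q) refl _ _ _ _ _ ⟩
    f 0 * (g 0 * h (suc k) + (tail g · h) k) + (tail f · (g · h)) k ∎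

  ·-identityˡ : ∀ f k → (constant 1# · f) k ≈ f k
  ·-identityˡ f k = trans (·-constant f (λ _ → refl) k) (*-identityˡ _)

  seriesRing : CommutativeRing c ℓ
  seriesRing = record
    { Carrier = Series
    ; _≈_ = _≋_
    ; _+_ = _⊕_
    ; _*_ = _·_
    ; -_  = ⊖_
    ; 0#  = λ _ → 0#
    ; 1#  = constant 1#
    ; isCommutativeRing = record
      { isRing = record
        { +-isAbelianGroup = record
          { isGroup = record
            { isMonoid = record
              { isSemigroup = record
                { isMagma = record
                  { isEquivalence = record
                    { refl  = coeffs λ _ → refl
                    ; sym   = λ p → coeffs λ k → sym (coeff p k)
                    ; trans = λ p q → coeffs λ k → trans (coeff p k) (coeff q k)
                    }
                  ; ∙-cong = λ p q → coeffs λ k → +-cong (coeff p k) (coeff q k)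
                  }
                ; assoc = λ f g h → coeffs λ k → +-assoc _ _ _
                }
              ; identity = (λ f → coeffs λ k → +-identityˡ _) , (λ f → coeffs λ k → +-identityʳ _)
              }
            ; inverse = (λ f → coeffs λ k → -‿inverseˡ _) , (λ f → coeffs λ k → -‿inverseʳ _)
            ; ⁻¹-cong = λ p → coeffs λ k → -‿cong (coeff p k)
            }
          ; comm = λ f g → coeffs λ k → +-comm _ _
          }
        ; *-cong = λ p q → coeffs (·-cong (coeff p) (coeff q))
        ; *-assoc = λ f g h → coeffs (·-assoc f g h)
        ; *-identity = (λ f → coeffs (·-identityˡ f)) ,
                       (λ f → coeffs λ k → trans (·-comm f _ k) (·-identityˡ f k))
        ; distrib = (λ h f g → coeffs λ k → trans (·-comm h _ k) (trans (·-distribʳ h f g k) (+-cong (·-comm f h k) (·-comm g h k)))) ,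
                    (λ h f g → coeffs (·-distribʳ h f g))
        }
      ; *-comm = λ f g → coeffs (·-comm f g)
      }
    }

  module S where
    open CommutativeRing seriesRing public hiding (zero)
    open Determinant seriesRing public
    open IntegerSolver seriesRing public
    open Algebra.Properties.Semiring.Mult (CommutativeRing.semiring seriesRing) public
    open Algebra.Properties.Semiring.Exp (CommutativeRing.semiring seriesRing) public using (_^_)

  private module ≋-Reasoning = Relation.Binary.Reasoning.Setoid S.setoid

  -- The Euler operator t · d/dt.
  E : Series → Series
  E f k = k ×′ f k

  -- The constant term of `E f` is zero and `tail (E f)` is `tail f ⊕ E (tail f)`, which makes the
  -- recursion of the product compatible with the weights k.
  E-* : ∀ f g k → E (f · g) k ≈ (E f · g) k + (f · E g) k
  E-* f g zero    = solve 2 (λ a b → con (+ 0) := con (+ 0) :* a :+ b :* con (+ 0)) refl _ _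
  E-* f g (suc k) = let open ≈-Reasoning in begin
    suc k ×′ (f 0 * g (suc k) + (tail f · g) k)
      ≈⟨ ×-distrib-+ _ _ (suc k) ⟩
    suc k ×′ (f 0 * g (suc k)) + ((tail f · g) k + k ×′ (tail f · g) k)
      ≈⟨ +-cong (sym (×-comm-* (suc k) _ _)) (+-congˡ (E-* (tail f) g k)) ⟩
    f 0 * (suc k ×′ g (suc k)) + ((tail f · g) k + ((E (tail f) · g) k + (tail f · E g) k))
      ≈⟨ solve 5 (λ x y p q r → x :+ (p :+ (q :+ r)) := con (+ 0) :* y :+ (p :+ q) :+ (x :+ r)) refl _ (g (suc k)) _ _ _ ⟩
    0# * g (suc k) + ((tail f · g) k + (E (tail f) · g) k) + (f 0 * (suc k ×′ g (suc k)) + (tail f · E g) k)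
      ≈⟨ +-congʳ (+-congˡ (·-distribʳ g (tail f) (E (tail f)) k)) ⟨
    (E f · g) (suc k) + (f · E g) (suc k) ∎

  open S.Derivation E
    (λ p → coeffs λ k → ×-congʳ k (coeff p k))
    (λ f g → coeffs λ k → ×-distrib-+ (f k) (g k) k)
    (λ f g → coeffs (E-* f g))

  coeff-sum : ∀ {n} (f : Fin n → Series) k → S.sum f k ≈ sum (λ i → f i k)
  coeff-sum {zero}  f k = trans (coeff (S.sum-zero f) k) (sym (sum-zero _))
  coeff-sum {suc n} f k = trans (coeff (S.sum-suc f) k) (trans (+-congˡ (coeff-sum (f ∘ suc) k)) (sym (sum-suc _)))

  coeff-sgn : ∀ e (f : Series) k → S.sgn e f k ≈ sgn e (f k)
  coeff-sgn zero    f k = refl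
  coeff-sgn (suc e) f k = -‿cong (coeff-sgn e f k)

  coeff-δ : ∀ {n} (i j : Fin n) → S.δ i j 0 ≈ δ i j
  coeff-δ i j with i Fin.≟ j
  ... | yes _ = refl
  ... | no  _ = refl

  det-constant-term : ∀ {n} (M : S.Matrix n) → (∀ i j → M i j 0 ≈ δ i j) → S.determinant M 0 ≈ 1#
  det-constant-term {zero}  M M≈δ = refl
  det-constant-term {suc n} M M≈δ = let open ≈-Reasoning in begin
    S.determinant M 0
      ≈⟨ trans (coeff-sum _ 0) (sum-suc _) ⟩
    M zero zero 0 * S.minor zero (M ∘ suc) 0
      + sum (λ j → S.sgn (toℕ (suc j)) (M zero (suc j) · S.minor (suc j) (M ∘ suc)) 0)
      ≈⟨ +-cong (*-cong (M≈δ zero zero) (det-constant-term (λ i j → M (suc i) (suc j)) (λ i j → M≈δ (suc i) (suc j))))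
           (sum-0 λ j → trans (coeff-sgn (toℕ (suc j)) (M zero (suc j) · S.minor (suc j) (M ∘ suc)) 0)
             (sgn-0 (toℕ (suc j)) (trans (*-congʳ (M≈δ zero (suc j))) (zeroˡ _)))) ⟩
    1# * 1# + 0#
      ≈⟨ trans (+-identityʳ _) (*-identityˡ _) ⟩
    1# ∎

  linear : Carrier → Carrier → Series
  linear a b zero          = a
  linear a b (suc zero)    = b
  linear a b (suc (suc k)) = 0#

  ·-linear : ∀ f a b k → (f · linear a b) (suc k) ≈ f (suc k) * a + f k * b
  ·-linear f a b zero    = +-comm _ _
  ·-linear f a b (suc k) = let open ≈-Reasoning in begin
    f 0 * 0# + (tail f · linear a b) (suc k)
      ≈⟨ +-cong (zeroʳ _) (·-linear (tail f) a b k) ⟩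
    0# + (f (suc (suc k)) * a + f (suc k) * b)
      ≈⟨ +-identityˡ _ ⟩
    f (suc (suc k)) * a + f (suc k) * b ∎

  ×-0 : ∀ n → n ×′ 0# ≈ 0#
  ×-0 zero    = refl
  ×-0 (suc n) = trans (+-identityˡ _) (×-0 n)

  E-linear : ∀ a b → E (linear a b) ≋ linear a b ⊕ ⊖ constant a
  E-linear a b = coeffs λ where
    zero          → sym (-‿inverseʳ a)
    (suc zero)    → +-congˡ (sym -0#≈0#)
    (suc (suc k)) → trans (×-0 (suc (suc k))) (sym (-‿inverseʳ 0#))

  -- With constant term 1 the coefficients of the other factor are determined one after another:
  -- compare constant terms, remove them, and pass to the tails.
  ·-cancelˡ : ∀ f g h → f 0 ≈ 1# → f · g ≋ f · h → g ≋ h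
  ·-cancelˡ f g h f₀≈1 fg≋fh = coeffs λ k → cancel g h (coeff fg≋fh) k
    where
    cancel₀ : ∀ x y → f 0 * x ≈ f 0 * y → x ≈ y
    cancel₀ x y eq = trans (sym (unit x)) (trans eq (unit y))
      where
      unit : ∀ x → f 0 * x ≈ x
      unit x = trans (*-congʳ f₀≈1) (*-identityˡ x)
    cancel : ∀ g h → (∀ k → (f · g) k ≈ (f · h) k) → ∀ k → g k ≈ h k
    cancel g h eq zero    = cancel₀ _ _ (eq zero)
    cancel g h eq (suc k) = cancel (tail g) (tail h) tails k
      where
      tails : ∀ k → (f · tail g) k ≈ (f · tail h) k
      tails k = +-cancelˡ (f (suc k) * g 0) _ _ (let open ≈-Reasoning in begin
        f (suc k) * g 0 + (f · tail g) k ≈⟨ ·-sucʳ f g k ⟨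
        (f · g) (suc k)                  ≈⟨ eq (suc k) ⟩
        (f · h) (suc k)                  ≈⟨ ·-sucʳ f h k ⟩
        f (suc k) * h 0 + (f · tail h) k ≈⟨ +-congʳ (*-congˡ (cancel₀ _ _ (eq zero))) ⟨
        f (suc k) * g 0 + (f · tail h) k ∎)

  -- Newton's identities: for f = ∏ (1 - aᵢ t) with d factors, s is the generating
  -- function of the power sums ∑ aᵢᵏ.
  PowerSums : Series → Series → Series → Set ℓ
  PowerSums d f s = d · f ≋ E f ⊕ f · s

  -- The relation expresses the logarithmic derivative E f / f as d - s, and logarithmic derivatives
  -- add up over products.
  PowerSums-· : ∀ {d e f g s u} → PowerSums d f s → PowerSums e g u → PowerSums (d ⊕ e) (f · g) (s ⊕ u)
  PowerSums-· {d} {e} {f} {g} {s} {u} p q = let open ≋-Reasoning in begin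
    (d ⊕ e) · (f · g)
      ≈⟨ S.solve 4 (λ d e f g → (d S.:+ e) S.:* (f S.:* g) S.:= (d S.:* f) S.:* g S.:+ f S.:* (e S.:* g)) S.refl d e f g ⟩
    d · f · g ⊕ f · (e · g)
      ≈⟨ S.+-cong (S.*-congʳ {g} p) (S.*-congˡ {f} q) ⟩
    (E f ⊕ f · s) · g ⊕ f · (E g ⊕ g · u)
      ≈⟨ S.solve 6 (λ f g s u x y → (x S.:+ f S.:* s) S.:* g S.:+ f S.:* (y S.:+ g S.:* u)
           S.:= (x S.:* g S.:+ f S.:* y) S.:+ (f S.:* g) S.:* (s S.:+ u)) S.refl f g s u (E f) (E g) ⟩
    (E f · g ⊕ f · E g) ⊕ f · g · (s ⊕ u)
      ≈⟨ S.+-congʳ (coeffs (E-* f g)) ⟨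
    E (f · g) ⊕ f · g · (s ⊕ u) ∎

  PowerSums-^ : ∀ {d f s} m → PowerSums d f s → PowerSums (m S.× d) (f S.^ m) (m S.× s)
  PowerSums-^ zero    p = coeffs λ k → let open ≈-Reasoning in begin
    ((λ _ → 0#) · constant 1#) k              ≈⟨ ·-zeroˡ (constant 1#) (λ _ → refl) k ⟩
    0#                                        ≈⟨ +-identityʳ 0# ⟨
    0# + 0#                                   ≈⟨ +-cong (sym (coeff E-1 k)) (sym (trans (·-comm (constant 1#) _ k) (·-zeroˡ (constant 1#) (λ _ → refl) k))) ⟩
    E (constant 1#) k + (constant 1# · (λ _ → 0#)) k ∎
  PowerSums-^ (suc m) p = PowerSums-· p (PowerSums-^ m p)

  geometric : Carrier → Series
  geometric a zero    = 1#
  geometric a (suc k) = a * geometric a k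

  -- `geometric a` is the inverse of 1 - a t, and E (1 - a t) = - a t.
  PowerSums-linear : ∀ a → PowerSums (constant 1#) (linear 1# (- a)) (geometric a)
  PowerSums-linear a = coeffs λ where
      zero → sym (+-identityˡ _)
      (suc k) → let open ≈-Reasoning in begin
        (constant 1# · linear 1# (- a)) (suc k)
          ≈⟨ ·-identityˡ _ (suc k) ⟩
        linear 1# (- a) (suc k)
          ≈⟨ lemma k ⟩
        E (linear 1# (- a)) (suc k)
          ≈⟨ +-identityʳ _ ⟨
        E (linear 1# (- a)) (suc k) + 0#
          ≈⟨ +-congˡ (trans (solve 2 (λ a g → con (+ 0) := a :* g :+ g :* :- a) refl a (geometric a k)) (+-congʳ (sym (*-identityʳ _)))) ⟩
        E (linear 1# (- a)) (suc k) + (a * geometric a k * 1# + geometric a k * - a)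
          ≈⟨ +-congˡ (trans (·-comm (linear 1# (- a)) _ (suc k)) (·-linear (geometric a) 1# (- a) k)) ⟨
        E (linear 1# (- a)) (suc k) + (linear 1# (- a) · geometric a) (suc k) ∎
    where
    lemma : ∀ k → linear 1# (- a) (suc k) ≈ suc k ×′ linear 1# (- a) (suc k)
    lemma zero    = sym (+-identityʳ _)
    lemma (suc k) = sym (×-0 (suc (suc k)))

  sum-const : ∀ n (f : Series) → S.sum {n} (λ _ → f) ≋ (n S.× constant 1#) · f
  sum-const zero    f = S.trans (S.sum-zero _) (S.sym (S.zeroˡ f))
  sum-const (suc n) f = S.trans (S.sum-suc _) (S.trans (S.+-congˡ {f} (sum-const n f))
    (S.trans (S.+-congʳ (S.sym (S.*-identityˡ f))) (S.sym (S.distribʳ f (constant 1#) (n S.× constant 1#)))))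

  -- Traces of powers from det (I - tA)

  module TraceFormula {n} (A : Matrix n) where
    power : ℕ → Matrix n
    power zero    = δ
    power (suc k) i j = sum (λ l → power k i l * A l j)

    trace : Series
    trace k = sum (λ i → power k i i)

    reversed : S.Matrix n
    reversed i j = linear (δ i j) (- A i j)

    resolvent : S.Matrix n
    resolvent i j k = power k i j

    -- (∑ Aᵏ tᵏ)(I - tA) telescopes: the coefficient of tᵏ⁺¹ is Aᵏ⁺¹ - Aᵏ A.
    resolvent-inverse : ∀ i j → S.sum (λ l → resolvent i l · reversed l j) ≋ S.δ i j
    resolvent-inverse i j = coeffs λ where
        zero → trans (coeff-sum _ 0) (trans (sum-δ (δ i) j) (sym (coeff-δ i j)))
        (suc k) → let open ≈-Reasoning in begin
          S.sum (λ l → resolvent i l · reversed l j) (suc k)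
            ≈⟨ coeff-sum _ (suc k) ⟩
          sum (λ l → (resolvent i l · reversed l j) (suc k))
            ≈⟨ sum-cong (λ l → ·-linear (resolvent i l) (δ l j) (- A l j) k) ⟩
          sum (λ l → power (suc k) i l * δ l j + power k i l * - A l j)
            ≈⟨ sum-+ _ _ ⟩
          sum (λ l → power (suc k) i l * δ l j) + sum (λ l → power k i l * - A l j)
            ≈⟨ +-cong (sum-δ (power (suc k) i) j) (sum-cong λ l → solve 2 (λ x y → x :* :- y := :- con (+ 1) :* (x :* y)) refl _ _) ⟩
          power (suc k) i j + sum (λ l → - (1# + 0#) * (power k i l * A l j))
            ≈⟨ +-congˡ (*-sumˡ (- (1# + 0#)) _) ⟨
          power (suc k) i j + - (1# + 0#) * power (suc k) i j
            ≈⟨ solve 1 (λ x → x :+ :- con (+ 1) :* x := con (+ 0)) refl _ ⟩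
          0#
            ≈⟨ δ-suc k ⟩
          S.δ i j (suc k) ∎
      where
      δ-suc : ∀ k → 0# ≈ S.δ i j (suc k)
      δ-suc k with i Fin.≟ j
      ... | yes _ = refl
      ... | no  _ = refl

    -- The derivative - tA is written as (I - tA) - I: in Jacobi's formula the first part restores
    -- the determinant and the second produces a diagonal entry of the adjugate.
    E-reversed : ∀ i j → E (reversed i j) ≋ reversed i j ⊕ ⊖ S.δ i j
    E-reversed i j with i Fin.≟ j
    ... | yes _ = E-linear 1# (- A i j)
    ... | no  _ = S.trans (E-linear 0# (- A i j))
                    (coeffs λ { zero → refl ; (suc _) → refl })

    -- A left inverse meets a right inverse up to the determinant P: with R the resolvent and N the
    -- adjugate, N = R (I - tA) N = R P.
    adjugate-resolvent : ∀ j i → S.adjugate reversed j i ≋ resolvent j i · S.determinant reversed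
    adjugate-resolvent j i = let open ≋-Reasoning in begin
      N j i
        ≈⟨ S.sum-δˡ (λ k → N k i) j ⟨
      S.sum (λ k → S.δ j k · N k i)
        ≈⟨ S.sum-cong (λ k → S.*-congʳ {N k i} (resolvent-inverse j k)) ⟨
      S.sum (λ k → S.sum (λ l → resolvent j l · reversed l k) · N k i)
        ≈⟨ S.sum-cong (λ k → S.*-sumʳ (N k i) _) ⟩
      S.sum (λ k → S.sum (λ l → resolvent j l · reversed l k · N k i))
        ≈⟨ S.sum-comm _ ⟩
      S.sum (λ l → S.sum (λ k → resolvent j l · reversed l k · N k i))
        ≈⟨ S.sum-cong (λ l → S.sum-cong (λ k → S.*-assoc (resolvent j l) (reversed l k) (N k i))) ⟩
      S.sum (λ l → S.sum (λ k → resolvent j l · (reversed l k · N k i)))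
        ≈⟨ S.sum-cong (λ l → S.*-sumˡ (resolvent j l) _) ⟨
      S.sum (λ l → resolvent j l · S.sum (λ k → reversed l k · N k i))
        ≈⟨ S.sum-cong (λ l → S.*-congˡ {resolvent j l} (S.adjugate-inverse reversed l i)) ⟩
      S.sum (λ l → resolvent j l · (S.determinant reversed · S.δ l i))
        ≈⟨ S.sum-cong (λ l → S.*-assoc (resolvent j l) (S.determinant reversed) (S.δ l i)) ⟨
      S.sum (λ l → resolvent j l · S.determinant reversed · S.δ l i)
        ≈⟨ S.sum-δ (λ l → resolvent j l · S.determinant reversed) i ⟩
      resolvent j i · S.determinant reversed ∎
      where
      N = S.adjugate reversed

    PowerSums-trace : PowerSums (n S.× constant 1#) (S.determinant reversed) trace
    PowerSums-trace = let open ≋-Reasoning in begin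
      (n S.× constant 1#) · P
        ≈⟨ sum-const n P ⟨
      S.sum {n} (λ _ → P)
        ≈⟨ S.sum-cong (λ i → row i) ⟩
      S.sum (λ i → S.determinant (reversed [ i ≔ E ∘ reversed i ]) ⊕ N i i)
        ≈⟨ S.sum-+ _ _ ⟩
      S.sum (λ i → S.determinant (reversed [ i ≔ E ∘ reversed i ])) ⊕ S.sum (λ i → N i i)
        ≈⟨ S.+-cong (S.sym (E-det reversed)) (S.sum-cong λ i → adjugate-resolvent i i) ⟩
      E P ⊕ S.sum (λ i → resolvent i i · P)
        ≈⟨ S.+-congˡ {E P} (S.*-sumʳ P _) ⟨
      E P ⊕ S.sum (λ i → resolvent i i) · P
        ≈⟨ S.+-congˡ {E P} (S.trans (S.*-congʳ {P} (coeffs (coeff-sum _))) (S.*-comm trace P)) ⟩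
      E P ⊕ P · trace ∎
      where
      P = S.determinant reversed
      N = S.adjugate reversed
      -- Differentiating row i turns P into P - `N i i`; summed over the rows this is E P = n P - tr
      -- N.
      row : ∀ i → P ≋ S.determinant (reversed [ i ≔ E ∘ reversed i ]) ⊕ N i i
      row i = S.sym (let open ≋-Reasoning in begin
        S.determinant (reversed [ i ≔ E ∘ reversed i ]) ⊕ N i i
          ≈⟨ S.+-cong (S.det-replace reversed i _) (S.sym (S.sum-δˡ (λ j → N j i) i)) ⟩
        S.sum (λ j → E (reversed i j) · N j i) ⊕ S.sum (λ j → S.δ i j · N j i)
          ≈⟨ S.sum-+ _ _ ⟨
        S.sum (λ j → E (reversed i j) · N j i ⊕ S.δ i j · N j i)
          ≈⟨ S.sum-cong (λ j → S.trans (S.+-congʳ {S.δ i j · N j i} (S.*-congʳ {N j i} (E-reversed i j)))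
               (S.solve 3 (λ m d p → (m S.:- d) S.:* p S.:+ d S.:* p S.:= m S.:* p) S.refl (reversed i j) (S.δ i j) (N j i))) ⟩
        S.sum (λ j → reversed i j · N j i)
          ≈⟨ S.adjugate-inverse reversed i i ⟩
        P · S.δ i i
          ≈⟨ S.*-congˡ {P} (S.reflexive (δ-diagonal i)) ⟩
        P · constant 1#
          ≈⟨ S.*-identityʳ P ⟩
        P ∎)
        where
        δ-diagonal : ∀ {n} (i : Fin n) → S.δ i i ≡ constant 1#
        δ-diagonal i with i Fin.≟ i
        ... | yes _  = ≡.refl
        ... | no i≢i with () ← i≢i ≡.refl

    power-+ : ∀ b a i j → power (b ℕ.+ a) i j ≈ sum (λ l → power a i l * power b l j)
    power-+ zero    a i j = sym (sum-δ (power a i) j)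
    power-+ (suc b) a i j = let open ≈-Reasoning in begin
      sum (λ l → power (b ℕ.+ a) i l * A l j)
        ≈⟨ sum-cong (λ l → trans (*-congʳ (power-+ b a i l)) (*-sumʳ (A l j) _)) ⟩
      sum (λ l → sum (λ p → power a i p * power b p l * A l j))
        ≈⟨ sum-comm _ ⟩
      sum (λ p → sum (λ l → power a i p * power b p l * A l j))
        ≈⟨ sum-cong (λ p → trans (sum-cong λ l → *-assoc _ _ _) (sym (*-sumˡ (power a i p) _))) ⟩
      sum (λ p → power a i p * power (suc b) p j) ∎

    power-1 : ∀ i j → power 1 i j ≈ A i j
    power-1 i j = sum-δˡ (λ l → A l j) i

    module Symmetric (A-sym : ∀ i j → A i j ≈ A j i) where
      power-sym : ∀ k i j → power k i j ≈ power k j i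
      power-sym zero    i j = δ-sym i j
      power-sym (suc k) i j = let open ≈-Reasoning in begin
        sum (λ l → power k i l * A l j)
          ≈⟨ sum-cong (λ l → trans (*-comm _ _) (*-cong (trans (A-sym l j) (sym (power-1 j l))) (power-sym k i l))) ⟩
        sum (λ l → power 1 j l * power k l i)
          ≈⟨ power-+ k 1 j i ⟨
        power (k ℕ.+ 1) j i
          ≡⟨ ≡.cong (λ e → power e j i) (ℕ.+-comm k 1) ⟩
        power (suc k) j i ∎

      -- The Frobenius inner product.
      ⟨_,_⟩ : Matrix n → Matrix n → Carrier
      ⟨ Y , Z ⟩ = sum (λ i → sum (λ j → Y i j * Z i j))

      power-pairing : ∀ k e → ⟨ power k , power e ⟩ ≈ trace (e ℕ.+ k)
      power-pairing k e = sum-cong λ i → trans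
        (sum-cong λ j → *-congˡ (power-sym e i j)) (sym (power-+ e k i i))

      module _ (a b : Carrier) where
        quadratic : (U V W : Carrier) → Carrier
        quadratic U V W = U - a * V + b * W

        sum-quadratic : ∀ {n} (u v w : Fin n → Carrier) →
          sum (λ i → quadratic (u i) (v i) (w i)) ≈ quadratic (sum u) (sum v) (sum w)
        sum-quadratic u v w = let open ≈-Reasoning in begin
          sum (λ i → quadratic (u i) (v i) (w i))
            ≈⟨ sum-cong (λ i → solve 5 (λ a b u v w → u :- a :* v :+ b :* w := u :+ ((:- a) :* v :+ b :* w)) refl a b _ _ _) ⟩
          sum (λ i → u i + (- a * v i + b * w i))
            ≈⟨ trans (sum-+ _ _) (+-congˡ (sum-+ _ _)) ⟩
          sum u + (sum (λ i → - a * v i) + sum (λ i → b * w i))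
            ≈⟨ +-congˡ (+-cong (*-sumˡ (- a) v) (*-sumˡ b w)) ⟨
          sum u + (- a * sum v + b * sum w)
            ≈⟨ solve 5 (λ a b u v w → u :+ ((:- a) :* v :+ b :* w) := u :- a :* v :+ b :* w) refl a b _ _ _ ⟩
          quadratic (sum u) (sum v) (sum w) ∎

        X : Matrix n
        X i j = quadratic (power 4 i j) (power 2 i j) (power 0 i j)

        power-pairing-X : ∀ k → ⟨ power k , X ⟩ ≈ quadratic (trace (4 ℕ.+ k)) (trace (2 ℕ.+ k)) (trace k)
        power-pairing-X k = let open ≈-Reasoning in begin
          ⟨ power k , X ⟩
            ≈⟨ sum-cong (λ i → trans (sum-cong λ j →
                 solve 6 (λ p a b u v w → p :* (u :- a :* v :+ b :* w) := p :* u :- a :* (p :* v) :+ b :* (p :* w)) refl (power k i j) a b _ _ _)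
                 (sum-quadratic _ _ _)) ⟩
          sum (λ i → quadratic (sum (λ j → power k i j * power 4 i j)) (sum (λ j → power k i j * power 2 i j)) (sum (λ j → power k i j * power 0 i j)))
            ≈⟨ sum-quadratic _ _ _ ⟩
          quadratic ⟨ power k , power 4 ⟩ ⟨ power k , power 2 ⟩ ⟨ power k , power 0 ⟩
            ≈⟨ quadratic-cong (power-pairing k 4) (power-pairing k 2) (power-pairing k 0) ⟩
          quadratic (trace (4 ℕ.+ k)) (trace (2 ℕ.+ k)) (trace k) ∎
          where
          quadratic-cong : ∀ {u u′ v v′ w w′} → u ≈ u′ → v ≈ v′ → w ≈ w′ → quadratic u v w ≈ quadratic u′ v′ w′
          quadratic-cong p q r = +-cong (+-cong p (-‿cong (*-congˡ q))) (*-congˡ r)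

        -- If A satisfied A⁴ - aA² + b = 0 its traces would satisfy this recurrence; conversely
        -- the recurrence makes A⁴ - aA² + b orthogonal to itself.
        X-isotropic : (∀ k → quadratic (trace (4 ℕ.+ k)) (trace (2 ℕ.+ k)) (trace k) ≈ 0#) → ⟨ X , X ⟩ ≈ 0#
        X-isotropic recurrence = let open ≈-Reasoning in begin
          ⟨ X , X ⟩
            ≈⟨ sum-cong (λ i → trans (sum-cong λ j →
                 solve 6 (λ p a b u v w → (u :- a :* v :+ b :* w) :* p := u :* p :- a :* (v :* p) :+ b :* (w :* p)) refl (X i j) a b _ _ _)
                 (sum-quadratic _ _ _)) ⟩
          sum (λ i → quadratic (sum (λ j → power 4 i j * X i j)) (sum (λ j → power 2 i j * X i j)) (sum (λ j → power 0 i j * X i j)))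
            ≈⟨ sum-quadratic _ _ _ ⟩
          quadratic ⟨ power 4 , X ⟩ ⟨ power 2 , X ⟩ ⟨ power 0 , X ⟩
            ≈⟨ +-cong (+-cong (orthogonal 4) (-‿cong (*-congˡ (orthogonal 2)))) (*-congˡ (orthogonal 0)) ⟩
          quadratic 0# 0# 0#
            ≈⟨ solve 2 (λ a b → con (+ 0) :- a :* con (+ 0) :+ b :* con (+ 0) := con (+ 0)) refl a b ⟩
          0# ∎
          where
          orthogonal : ∀ k → ⟨ power k , X ⟩ ≈ 0#
          orthogonal k = trans (power-pairing-X k) (recurrence k)

  -- Polynomials as series of bounded degree, and their values

  DegreeAtMost : ℕ → Series → Set ℓ
  DegreeAtMost d f = ∀ k → d ℕ.< k → f k ≈ 0#

  degree-· : ∀ {d e f g} → DegreeAtMost d f → DegreeAtMost e g → DegreeAtMost (d ℕ.+ e) (f · g)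
  degree-· {zero}  {e} {f} {g} F G k       e<k = trans (·-constant g (λ j → F (suc j) (s≤s z≤n)) k) (trans (*-congˡ (G k e<k)) (zeroʳ _))
  degree-· {suc d} {e} {f} {g} F G (suc k) (s≤s d+e<k) = trans
    (+-cong (trans (*-congˡ (G (suc k) (s≤s (ℕ.≤-trans (ℕ.m≤n+m e d) (ℕ.<⇒≤ d+e<k))))) (zeroʳ _))
      (degree-· {d} {e} (λ j d<j → F (suc j) (s≤s d<j)) G k d+e<k))
    (+-identityˡ _)

  degree-linear : ∀ a b → DegreeAtMost 1 (linear a b)
  degree-linear a b (suc zero)    (s≤s ())
  degree-linear a b (suc (suc k)) _ = refl

  degree-det : ∀ {n} (M : S.Matrix n) → (∀ i j → DegreeAtMost 1 (M i j)) → DegreeAtMost n (S.determinant M)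
  degree-det {zero}  M M₁ (suc k) _ = refl
  degree-det {suc n} M M₁ k n<k = trans (coeff-sum _ k) (sum-0 λ j →
    trans (coeff-sgn (toℕ j) (M zero j · S.minor j (M ∘ suc)) k)
      (sgn-0 (toℕ j) (degree-· (M₁ zero j) (degree-det _ (λ i l → M₁ (suc i) (punchIn j l))) k n<k)))

  -- Evaluation at x of the reversed polynomial f₀ xᵈ + f₁ xᵈ⁻¹ + … + f_d.
  module Evaluation (x : Carrier) where
    open Algebra.Properties.Semiring.Exp semiring using (_^_; ^-homo-*)

    eval : ℕ → Series → Carrier
    eval zero    f = f 0
    eval (suc d) f = f 0 * x ^ suc d + eval d (tail f)

    eval-cong : ∀ d {f g} → (∀ k → f k ≈ g k) → eval d f ≈ eval d g
    eval-cong zero    f≈g = f≈g 0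
    eval-cong (suc d) f≈g = +-cong (*-congʳ (f≈g 0)) (eval-cong d (f≈g ∘ suc))

    eval-+ : ∀ d f g → eval d (f ⊕ g) ≈ eval d f + eval d g
    eval-+ zero    f g = refl
    eval-+ (suc d) f g = trans (+-congˡ (eval-+ d (tail f) (tail g)))
      (solve 5 (λ a b y p q → (a :+ b) :* y :+ (p :+ q) := (a :* y :+ p) :+ (b :* y :+ q)) refl _ _ _ _ _)

    eval-scale : ∀ d y f → eval d (λ k → y * f k) ≈ y * eval d f
    eval-scale zero    y f = refl
    eval-scale (suc d) y f = trans (+-congˡ (eval-scale d y (tail f)))
      (solve 4 (λ y a z p → y :* a :* z :+ y :* p := y :* (a :* z :+ p)) refl _ _ _ _)

    eval-neg : ∀ d f → eval d (⊖ f) ≈ - eval d f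
    eval-neg zero    f = refl
    eval-neg (suc d) f = trans (+-congˡ (eval-neg d (tail f)))
      (solve 3 (λ a z p → (:- a) :* z :+ :- p := :- (a :* z :+ p)) refl _ _ _)

    eval-0 : ∀ d {f} → (∀ k → f k ≈ 0#) → eval d f ≈ 0#
    eval-0 zero    f≈0 = f≈0 0
    eval-0 (suc d) f≈0 = trans (+-cong (trans (*-congʳ (f≈0 0)) (zeroˡ _)) (eval-0 d (f≈0 ∘ suc))) (+-identityˡ _)

    -- The value depends on the declared degree and not on the series alone; declaring d more costs
    -- a factor xᵈ.
    eval-pad : ∀ d e g → DegreeAtMost e g → eval (d ℕ.+ e) g ≈ x ^ d * eval e g
    eval-pad d e g G = trans (reflexive (≡.cong (λ c → eval c g) (ℕ.+-comm d e))) (pad e g G)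
      where
      pad : ∀ e g → DegreeAtMost e g → eval (e ℕ.+ d) g ≈ x ^ d * eval e g
      pad zero    g G = constants d
        where
        constants : ∀ d → eval d g ≈ x ^ d * g 0
        constants zero    = sym (*-identityˡ _)
        constants (suc d) = trans (+-congˡ (eval-0 d λ k → G (suc k) (s≤s z≤n))) (trans (+-identityʳ _) (*-comm _ _))
      pad (suc e) g G = trans
        (+-cong (*-congˡ (^-homo-* x (suc e) d)) (pad e (tail g) (λ k e<k → G (suc k) (s≤s e<k))))
        (solve 4 (λ a y z p → a :* (y :* z) :+ z :* p := z :* (a :* y :+ p)) refl _ _ _ _)

    eval-· : ∀ d e f g → DegreeAtMost d f → DegreeAtMost e g → eval (d ℕ.+ e) (f · g) ≈ eval d f * eval e g
    eval-· zero    e f g F G = trans (eval-cong e (·-constant g λ k → F (suc k) (s≤s z≤n))) (eval-scale e (f 0) g)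
    eval-· (suc d) e f g F G = let open ≈-Reasoning in begin
      f 0 * g 0 * x ^ suc (d ℕ.+ e) + eval (d ℕ.+ e) (tail (f · g))
        ≈⟨ +-congˡ (trans (eval-+ (d ℕ.+ e) (λ k → f 0 * g (suc k)) (tail f · g))
             (+-cong (eval-scale (d ℕ.+ e) (f 0) (tail g)) (eval-· d e (tail f) g (λ k d<k → F (suc k) (s≤s d<k)) G))) ⟩
      f 0 * g 0 * x ^ suc (d ℕ.+ e) + (f 0 * eval (d ℕ.+ e) (tail g) + eval d (tail f) * eval e g)
        ≈⟨ solve 5 (λ a b y p q → a :* b :* y :+ (a :* p :+ q) := a :* (b :* y :+ p) :+ q) refl _ _ _ _ _ ⟩
      f 0 * eval (suc (d ℕ.+ e)) g + eval d (tail f) * eval e g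
        ≈⟨ +-congʳ (*-congˡ (eval-pad (suc d) e g G)) ⟩
      f 0 * (x ^ suc d * eval e g) + eval d (tail f) * eval e g
        ≈⟨ solve 4 (λ a y p q → a :* (y :* p) :+ q :* p := (a :* y :+ q) :* p) refl _ _ _ _ ⟩
      eval (suc d) f * eval e g ∎

    eval-snoc : ∀ d f → eval (suc d) f ≈ x * eval d f + f (suc d)
    eval-snoc zero    f = +-congʳ (trans (*-congˡ (*-identityʳ x)) (*-comm _ _))
    eval-snoc (suc d) f = trans (+-congˡ (eval-snoc d (tail f)))
      (solve 5 (λ a x y p q → a :* (x :* y) :+ (x :* p :+ q) := x :* (a :* y :+ p) :+ q) refl _ _ _ _ _)

    eval-sgn : ∀ e d f → eval d (S.sgn e f) ≈ sgn e (eval d f)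
    eval-sgn zero    d f = refl
    eval-sgn (suc e) d f = trans (eval-neg d _) (-‿cong (eval-sgn e d f))

    eval-sum : ∀ d {n} (f : Fin n → Series) → eval d (S.sum f) ≈ sum (λ i → eval d (f i))
    eval-sum d {zero}  f = trans (eval-0 d λ k → coeff (S.sum-zero f) k) (sym (sum-zero _))
    eval-sum d {suc n} f = trans (eval-cong d (coeff (S.sum-suc f)))
      (trans (eval-+ d (f zero) _) (trans (+-congˡ (eval-sum d (f ∘ suc))) (sym (sum-suc _))))

    -- Homogenising the entries in degree 1 homogenises the determinant in degree n. This carries
    -- det (I - tA) to det (xI - A) without inverting x.
    eval-det : ∀ {n} (M : S.Matrix n) → (∀ i j → DegreeAtMost 1 (M i j)) →
      eval n (S.determinant M) ≈ determinant (λ i j → eval 1 (M i j))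
    eval-det {zero}  M M₁ = refl
    eval-det {suc n} M M₁ = trans (eval-sum (suc n) _) (sum-cong λ j →
      trans (eval-sgn (toℕ j) (suc n) (M zero j · S.minor j (M ∘ suc)))
        (sgn-cong (toℕ j) (trans
          (eval-· 1 n (M zero j) _ (M₁ zero j) (degree-det _ (λ i l → M₁ (suc i) (punchIn j l))))
          (*-congˡ (eval-det _ (λ i l → M₁ (suc i) (punchIn j l)))))))

  open Evaluation using (eval; eval-snoc)

  -- Synthetic division by x - b: the quotient's coefficients are the Horner partial values.
  eval-division : ∀ x b d f →
    eval x (suc d) f - eval b (suc d) f ≈ (x - b) * eval x d (λ k → eval b k f)
  eval-division x b zero    f = trans (+-cong (eval-snoc x 0 f) (-‿cong (eval-snoc b 0 f)))
    (solve 4 (λ x b p q → (x :* p :+ q) :- (b :* p :+ q) := (x :- b) :* p) refl x b _ _)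
  eval-division x b (suc d) f = let open ≈-Reasoning in begin
    eval x (suc (suc d)) f - eval b (suc (suc d)) f
      ≈⟨ +-cong (eval-snoc x (suc d) f) (-‿cong (eval-snoc b (suc d) f)) ⟩
    (x * eval x (suc d) f + f (suc (suc d))) - (b * eval b (suc d) f + f (suc (suc d)))
      ≈⟨ solve 5 (λ x b p q r → (x :* p :+ r) :- (b :* q :+ r) := x :* (p :- q) :+ (x :- b) :* q) refl x b _ _ _ ⟩
    x * (eval x (suc d) f - eval b (suc d) f) + (x - b) * eval b (suc d) f
      ≈⟨ +-congʳ (*-congˡ (eval-division x b d f)) ⟩
    x * ((x - b) * eval x d (λ k → eval b k f)) + (x - b) * eval b (suc d) f
      ≈⟨ solve 4 (λ x b p q → x :* ((x :- b) :* p) :+ (x :- b) :* q := (x :- b) :* (x :* p :+ q)) refl x b _ _ ⟩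
    (x - b) * (x * eval x d (λ k → eval b k f) + eval b (suc d) f)
      ≈⟨ *-congˡ (eval-snoc x d (λ k → eval b k f)) ⟨
    (x - b) * eval x (suc d) (λ k → eval b k f) ∎

-- Ordered fields and the spectrum

module OrderedFieldProperties {c ℓ₁ ℓ₂} (F : OrderedField c ℓ₁ ℓ₂) where
  open OrderedField F hiding (zero)
  open IsStrictTotalOrder isStrictTotalOrder using (compare; <-respˡ-≈; <-respʳ-≈)
    renaming (trans to <-trans; irrefl to <-irrefl)
  open IntegerSolver commutativeRing
  open Determinant commutativeRing
  open PowerSeries commutativeRing
  open Algebra.Properties.Semiring.Mult semiring using (×-congʳ) renaming (_×_ to _×′_)
  open Algebra.Properties.Ring ring using (-0#≈0#; +-cancelˡ)
  private module ≈-Reasoning = Relation.Binary.Reasoning.Setoid setoid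

  x-y≈0⇒x≈y : ∀ {x y} → x - y ≈ 0# → x ≈ y
  x-y≈0⇒x≈y {x} {y} eq = trans (solve 2 (λ x y → x := (x :- y) :+ y) refl x y) (trans (+-congʳ eq) (+-identityˡ y))

  x<y⇒0<y-x : ∀ {x y} → x < y → 0# < (y - x)
  x<y⇒0<y-x {x} x<y = <-respˡ-≈ (-‿inverseʳ x) (+-mono-< (- x) x<y)

  x≤y⇒0≤y-x : ∀ {x y} → x ≤ y → 0# ≤ (y - x)
  x≤y⇒0≤y-x (inj₁ x<y) = inj₁ (x<y⇒0<y-x x<y)
  x≤y⇒0≤y-x (inj₂ x≈y) = inj₂ (trans (sym (-‿inverseʳ _)) (+-congʳ x≈y))

  ≤-respʳ-≈ : ∀ {x y} → x ≈ y → 0# ≤ x → 0# ≤ y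
  ≤-respʳ-≈ x≈y (inj₁ 0<x) = inj₁ (<-respʳ-≈ x≈y 0<x)
  ≤-respʳ-≈ x≈y (inj₂ 0≈x) = inj₂ (trans 0≈x x≈y)

  0<x+y : ∀ {x y} → 0# < x → 0# ≤ y → 0# < (x + y)
  0<x+y {x} {y} 0<x (inj₁ 0<y) = <-trans 0<y (<-respˡ-≈ (+-identityˡ y) (+-mono-< y 0<x))
  0<x+y {x} {y} 0<x (inj₂ 0≈y) = <-respʳ-≈ (trans (sym (+-identityʳ x)) (+-congˡ 0≈y)) 0<x

  0≤x+y : ∀ {x y} → 0# ≤ x → 0# ≤ y → 0# ≤ (x + y)
  0≤x+y (inj₁ 0<x) 0≤y = inj₁ (0<x+y 0<x 0≤y)
  0≤x+y {x} {y} (inj₂ 0≈x) 0≤y = ≤-respʳ-≈ (trans (sym (+-identityˡ y)) (+-congʳ 0≈x)) 0≤y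

  0≤x*y : ∀ {x y} → 0# ≤ x → 0# ≤ y → 0# ≤ (x * y)
  0≤x*y (inj₁ 0<x) (inj₁ 0<y) = inj₁ (*-pos 0<x 0<y)
  0≤x*y (inj₁ _) (inj₂ 0≈y) = inj₂ (trans (sym (zeroʳ _)) (*-congˡ 0≈y))
  0≤x*y (inj₂ 0≈x) _ = inj₂ (trans (sym (zeroˡ _)) (*-congʳ 0≈x))

  1≤x⇒0<x : ∀ {x} → 1# ≤ x → 0# < x
  1≤x⇒0<x (inj₁ 1<x) = <-trans 0<1 1<x
  1≤x⇒0<x (inj₂ 1≈x) = <-respʳ-≈ 1≈x 0<1

  x<0⇒0<-x : ∀ {x} → x < 0# → 0# < (- x)
  x<0⇒0<-x x<0 = <-respʳ-≈ (+-identityˡ _) (x<y⇒0<y-x x<0)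

  0≤x*x : ∀ x → 0# ≤ (x * x)
  0≤x*x x with compare x 0#
  ... | tri< x<0 _ _ = inj₁ (<-respʳ-≈ (solve 1 (λ x → (:- x) :* (:- x) := x :* x) refl x) (*-pos (x<0⇒0<-x x<0) (x<0⇒0<-x x<0)))
  ... | tri≈ _ x≈0 _ = inj₂ (sym (trans (*-congˡ x≈0) (zeroʳ x)))
  ... | tri> _ _ 0<x = inj₁ (*-pos 0<x 0<x)

  0<x⇒x≉0 : ∀ {x} → 0# < x → ¬ x ≈ 0#
  0<x⇒x≉0 0<x x≈0 = <-irrefl (sym x≈0) 0<x

  0<x⇒0≰-x : ∀ {x} → 0# < x → ¬ 0# ≤ (- x)
  0<x⇒0≰-x {x} 0<x 0≤-x = <-irrefl (sym (-‿inverseʳ x)) (0<x+y 0<x 0≤-x)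

  ≮0⇒0≤ : ∀ {x} → ¬ x < 0# → 0# ≤ x
  ≮0⇒0≤ {x} x≮0 with compare x 0#
  ... | tri< x<0 _ _ = contradiction x<0 x≮0
  ... | tri≈ _ x≈0 _ = inj₂ (sym x≈0)
  ... | tri> _ _ 0<x = inj₁ 0<x

  *-cancel-0 : ∀ {x y} → ¬ x ≈ 0# → x * y ≈ 0# → y ≈ 0#
  *-cancel-0 {x} {y} x≉0 xy≈0 with inverse x x≉0
  ... | x⁻¹ , xx⁻¹≈1 = let open ≈-Reasoning in begin
    y                 ≈⟨ *-identityˡ y ⟨
    1# * y            ≈⟨ *-congʳ xx⁻¹≈1 ⟨
    x * x⁻¹ * y       ≈⟨ solve 3 (λ x z y → x :* z :* y := z :* (x :* y)) refl x x⁻¹ y ⟩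
    x⁻¹ * (x * y)     ≈⟨ trans (*-congˡ xy≈0) (zeroʳ x⁻¹) ⟩
    0#                ∎

  x*x≈0⇒x≈0 : ∀ {x} → x * x ≈ 0# → x ≈ 0#
  x*x≈0⇒x≈0 {x} xx≈0 with compare x 0#
  ... | tri< _ x≉0 _ = *-cancel-0 x≉0 xx≈0
  ... | tri≈ _ x≈0 _ = x≈0
  ... | tri> _ x≉0 _ = *-cancel-0 x≉0 xx≈0

  sum-nonneg : ∀ {n} {f : Fin n → Carrier} → (∀ i → 0# ≤ f i) → 0# ≤ sum f
  sum-nonneg {zero}  f≥0 = inj₂ (sym (sum-zero _))
  sum-nonneg {suc n} f≥0 = ≤-respʳ-≈ (sym (sum-suc _)) (0≤x+y (f≥0 zero) (sum-nonneg (f≥0 ∘ suc)))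

  sum-nonneg-0 : ∀ {n} {f : Fin n → Carrier} → (∀ i → 0# ≤ f i) → 0# ≤ (- sum f) → ∀ i → f i ≈ 0#
  sum-nonneg-0 {suc n} {f} f≥0 sum≤0 i with f≥0 i
  ... | inj₂ 0≈fi = sym 0≈fi
  ... | inj₁ 0<fi = contradiction sum≤0 (0<x⇒0≰-x (positive f f≥0 i 0<fi))
    where
    positive : ∀ {n} (f : Fin n → Carrier) → (∀ i → 0# ≤ f i) → ∀ i → 0# < f i → 0# < sum f
    positive f f≥0 zero    0<f = <-respʳ-≈ (sym (sum-suc f)) (0<x+y 0<f (sum-nonneg (f≥0 ∘ suc)))
    positive f f≥0 (suc i) 0<f = <-respʳ-≈ (trans (+-comm _ _) (sym (sum-suc f)))
      (0<x+y (positive (f ∘ suc) (f≥0 ∘ suc) i 0<f) (f≥0 zero))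

  0<suc×1 : ∀ m → 0# < (suc m ×′ 1#)
  0<suc×1 m = 0<x+y 0<1 (0≤×1 m)
    where
    0≤×1 : ∀ m → 0# ≤ (m ×′ 1#)
    0≤×1 zero    = inj₂ refl
    0≤×1 (suc m) = inj₁ (0<suc×1 m)

  0<×1 : ∀ {m} → 1 ℕ.≤ m → 0# < (m ×′ 1#)
  0<×1 (s≤s {n = m} _) = 0<suc×1 m

  ×1-injective : ∀ m n → m ×′ 1# ≈ n ×′ 1# → m ≡ n
  ×1-injective zero    zero    eq = ≡.refl
  ×1-injective zero    (suc n) eq = contradiction (sym eq) (0<x⇒x≉0 (0<suc×1 n))
  ×1-injective (suc m) zero    eq = contradiction eq (0<x⇒x≉0 (0<suc×1 m))
  ×1-injective (suc m) (suc n) eq = ≡.cong suc (×1-injective m n (+-cancelˡ 1# _ _ eq))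

  -- Polynomial functions determine polynomials over an ordered field

  open Evaluation using (eval; eval-snoc; eval-+; eval-neg)

  -- Vanishing is assumed beyond a bound b so that the induction applies to the quotient: b + 1 is a
  -- root, and beyond it x - (b + 1) is invertible.
  eval-vanishing : ∀ d f b → (∀ x → b < x → eval x d f ≈ 0#) → ∀ k → k ℕ.≤ d → f k ≈ 0#
  eval-vanishing zero f b vanish zero z≤n = vanish (b + 1#) (<-respˡ-≈ (+-identityˡ b) (<-respʳ-≈ (+-comm 1# b) (+-mono-< b 0<1)))
  eval-vanishing (suc d) f b vanish = coefficients
    where
    b′ = b + 1#
    b<b′ : b < b′
    b<b′ = <-respˡ-≈ (+-identityˡ b) (<-respʳ-≈ (+-comm 1# b) (+-mono-< b 0<1))
    quotient-vanishes : ∀ x → b′ < x → eval x d (λ k → eval b′ k f) ≈ 0#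
    quotient-vanishes x b′<x = *-cancel-0 (0<x⇒x≉0 (x<y⇒0<y-x b′<x))
      (trans (sym (eval-division x b′ d f)) (trans (+-cong (vanish x (<-trans b<b′ b′<x)) (-‿cong (vanish b′ b<b′))) (-‿inverseʳ 0#)))
    -- All Horner values at `b′` vanish: up to index d they are the coefficients of the quotient,
    -- and the last one is the remainder. Two consecutive ones recover a coefficient of f.
    partial : ∀ k → k ℕ.≤ suc d → eval b′ k f ≈ 0#
    partial k k≤1+d with ℕ.m≤n⇒m<n∨m≡n k≤1+d
    ... | inj₁ (s≤s k≤d) = eval-vanishing d (λ k → eval b′ k f) b′ quotient-vanishes k k≤d
    ... | inj₂ ≡.refl    = vanish b′ b<b′
    coefficients : ∀ k → k ℕ.≤ suc d → f k ≈ 0#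
    coefficients zero    _  = partial zero z≤n
    coefficients (suc k) 1+k≤1+d = let open ≈-Reasoning in begin
      f (suc k)
        ≈⟨ solve 3 (λ b p q → q := (b :* p :+ q) :- b :* p) refl b′ (eval b′ k f) _ ⟩
      b′ * eval b′ k f + f (suc k) - b′ * eval b′ k f
        ≈⟨ +-cong (trans (sym (eval-snoc b′ k f)) (partial (suc k) 1+k≤1+d))
             (-‿cong (trans (*-congˡ (partial k (ℕ.≤-trans (ℕ.n≤1+n k) 1+k≤1+d))) (zeroʳ b′))) ⟩
      0# - 0#
        ≈⟨ -‿inverseʳ 0# ⟩
      0# ∎

  eval-injective : ∀ d f g → (∀ x → eval x d f ≈ eval x d g) → ∀ k → k ℕ.≤ d → f k ≈ g k
  eval-injective d f g eq k k≤d = x-y≈0⇒x≈y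
    (eval-vanishing d (f ⊕ ⊖ g) 0# (λ x _ → trans (eval-+ x d f (⊖ g))
      (trans (+-cong (eq x) (eval-neg x d g)) (-‿inverseʳ _))) k k≤d)

  -- Multiplication by tᵉ. For the reversed evaluation this inserts e zero leading coefficients, so
  -- that polynomials of different declared degrees become comparable.
  delay : ℕ → Series → Series
  delay zero    f k       = f k
  delay (suc e) f zero    = 0#
  delay (suc e) f (suc k) = delay e f k

  eval-delay : ∀ x e d f → eval x (e ℕ.+ d) (delay e f) ≈ eval x d f
  eval-delay x zero    d f = refl
  eval-delay x (suc e) d f = trans (+-cong (zeroˡ _) (eval-delay x e d f)) (+-identityˡ _)

  -- `g 0` is the coefficient of xᵉ. For d < e, f padded with zero leading coefficients would force
  -- it to be 0.
  eval-degree-≮ : ∀ {d e f g} → g 0 ≈ 1# → (∀ x → eval x d f ≈ eval x e g) → ¬ d ℕ.< e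
  eval-degree-≮ {d} {e} {f} {g} g₀≈1 eq d<e with e ℕ.∸ suc d in eq′
  ... | k with ≡.refl ← ≡.trans (≡.sym (ℕ.m∸n+n≡m d<e)) (≡.trans (≡.cong (ℕ._+ suc d) eq′) (ℕ.+-suc k d)) =
    0<x⇒x≉0 0<1 (trans (sym g₀≈1) (sym
      (eval-injective (suc k ℕ.+ d) (delay (suc k) f) g (λ x → trans (eval-delay x (suc k) d f) (eq x)) 0 z≤n)))

  eval-determines : ∀ {d e f g} → f 0 ≈ 1# → g 0 ≈ 1# → DegreeAtMost d f → DegreeAtMost e g →
    (∀ x → eval x d f ≈ eval x e g) → d ≡ e × f ≋ g
  eval-determines {d} {e} {f} {g} f₀≈1 g₀≈1 F G eq with ℕ.<-cmp d e
  ... | tri< d<e _ _ = contradiction d<e (eval-degree-≮ {f = f} g₀≈1 eq)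
  ... | tri> _ _ e<d = contradiction e<d (eval-degree-≮ {f = g} f₀≈1 (λ x → sym (eq x)))
  ... | tri≈ _ ≡.refl _ = ≡.refl , coeffs coefficient
    where
    coefficient : ∀ k → f k ≈ g k
    coefficient k with k ℕ.≤? d
    ... | yes k≤d = eval-injective d f g eq k k≤d
    ... | no  k≰d = trans (F k (ℕ.≰⇒> k≰d)) (sym (G k (ℕ.≰⇒> k≰d)))

  det≈Defs-det : ∀ {n} (M : Matrix n) → det F M ≈ determinant M
  det≈Defs-det {zero}  M = refl
  det≈Defs-det {suc n} M = trans (sumF≈sum _) (sum-cong λ j →
    trans (altSign≈sgn (toℕ j) _) (sgn-cong (toℕ j) (*-congˡ (det≈Defs-det (λ i → M (suc i) ∘ punchIn j)))))
    where
    sumF≈sum : ∀ {n} (f : Fin n → Carrier) → sumF F f ≈ sum f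
    sumF≈sum {zero}  f = sym (sum-zero f)
    sumF≈sum {suc n} f = trans (+-congˡ (sumF≈sum (f ∘ suc))) (sym (sum-suc f))
    altSign≈sgn : ∀ k x → altSign F k x ≈ sgn k x
    altSign≈sgn zero    x = refl
    altSign≈sgn (suc k) x = -‿cong (altSign≈sgn k x)

  -- 1 - a² t², kept as a product so that a and - a can be read off by `PowerSums-linear`; this is
  -- why the second factor has `- - a`.
  quadraticFactor : Carrier → Series
  quadraticFactor a = linear 1# (- a) · linear 1# (- - a)

  eval-linear : ∀ x a b → eval x 1 (linear a b) ≈ a * x + b
  eval-linear x a b = +-congʳ (*-congˡ (*-identityʳ x))

  eval-quadraticFactor : ∀ x a → eval x 2 (quadraticFactor a) ≈ x * x - a * a
  eval-quadraticFactor x a = let open ≈-Reasoning in begin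
    eval x 2 (quadraticFactor a)
      ≈⟨ Evaluation.eval-· x 1 1 (linear 1# (- a)) (linear 1# (- - a)) (degree-linear _ _) (degree-linear _ _) ⟩
    eval x 1 (linear 1# (- a)) * eval x 1 (linear 1# (- - a))
      ≈⟨ *-cong (trans (eval-linear x _ _) (+-congʳ (*-identityˡ x))) (trans (eval-linear x _ _) (+-congʳ (*-identityˡ x))) ⟩
    (x - a) * (x - - a)
      ≈⟨ solve 2 (λ x a → (x :- a) :* (x :- (:- a)) := x :* x :- a :* a) refl x a ⟩
    x * x - a * a ∎

  degree-quadraticFactor : ∀ a → DegreeAtMost 2 (quadraticFactor a)
  degree-quadraticFactor a = degree-· {1} {1} (degree-linear _ _) (degree-linear _ _)

  degree-^ : ∀ {d f} m → DegreeAtMost d f → DegreeAtMost (m ℕ.* d) (f S.^ m)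
  degree-^ {d}     zero    D (suc k) _ = refl
  degree-^ {d} {f} (suc m) D = degree-· {d} {m ℕ.* d} D (degree-^ {d} {f} m D)

  eval-^ : ∀ x {d f} m → DegreeAtMost d f → eval x (m ℕ.* d) (f S.^ m) ≈ pow F (eval x d f) m
  eval-^ x         zero    D = refl
  eval-^ x {d} {f} (suc m) D = trans (Evaluation.eval-· x d (m ℕ.* d) f (f S.^ m) D (degree-^ {d} {f} m D))
    (*-congˡ (eval-^ x {d} {f} m D))

  pow-cong : ∀ m {x y} → x ≈ y → pow F x m ≈ pow F y m
  pow-cong zero    x≈y = refl
  pow-cong (suc m) x≈y = *-cong x≈y (pow-cong m x≈y)

  coeff-× : ∀ m f k → (m S.× f) k ≈ m ×′ 1# * f k
  coeff-× zero    f k = sym (zeroˡ _)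
  coeff-× (suc m) f k = trans (+-cong (sym (*-identityˡ _)) (coeff-× m f k)) (sym (distribʳ (f k) 1# (m ×′ 1#)))

  -- From the characteristic polynomial to B² = θB

  module Spectrum {n} (A : Matrix n) (A-sym : ∀ i j → A i j ≈ A j i) (m : ℕ) (l μ : Carrier)
    (charPoly : ∀ x → det F (λ i j → (if does (i Fin.≟ j) then x else 0#) - A i j)
                    ≈ pow F (x * x - l * l) m * (x * x - μ * μ))
    where
    open TraceFormula A
    open Symmetric A-sym

    Q : Series
    Q = quadraticFactor l S.^ m · quadraticFactor μ

    eval-Q : ∀ x → eval x (m ℕ.* 2 ℕ.+ 2) Q ≈ pow F (x * x - l * l) m * (x * x - μ * μ)
    eval-Q x = trans
      (Evaluation.eval-· x (m ℕ.* 2) 2 (quadraticFactor l S.^ m) (quadraticFactor μ)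
        (degree-^ {2} {quadraticFactor l} m (degree-quadraticFactor l)) (degree-quadraticFactor μ))
      (*-cong (trans (eval-^ x {2} {quadraticFactor l} m (degree-quadraticFactor l)) (pow-cong m (eval-quadraticFactor x l)))
        (eval-quadraticFactor x μ))

    eval-reversed : ∀ x i j → eval x 1 (reversed i j) ≈ (if does (i Fin.≟ j) then x else 0#) - A i j
    eval-reversed x i j = trans (eval-linear x (δ i j) (- A i j)) (+-congʳ diagonal)
      where
      diagonal : δ i j * x ≈ (if does (i Fin.≟ j) then x else 0#)
      diagonal with i Fin.≟ j
      ... | yes _ = *-identityˡ x
      ... | no  _ = zeroˡ x

    eval-det-reversed : ∀ x → eval x n (S.determinant reversed) ≈ eval x (m ℕ.* 2 ℕ.+ 2) Q
    eval-det-reversed x = let open ≈-Reasoning in begin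
      eval x n (S.determinant reversed)
        ≈⟨ Evaluation.eval-det x reversed (λ i j → degree-linear _ _) ⟩
      determinant (λ i j → eval x 1 (reversed i j))
        ≈⟨ det-cong (eval-reversed x) ⟩
      determinant (λ i j → (if does (i Fin.≟ j) then x else 0#) - A i j)
        ≈⟨ det≈Defs-det (λ i j → (if does (i Fin.≟ j) then x else 0#) - A i j) ⟨
      det F (λ i j → (if does (i Fin.≟ j) then x else 0#) - A i j)
        ≈⟨ trans (charPoly x) (sym (eval-Q x)) ⟩
      eval x (m ℕ.* 2 ℕ.+ 2) Q ∎

    Q₀≈1 : Q 0 ≈ 1#
    Q₀≈1 = trans (*-cong (power₀ m) (*-identityˡ 1#)) (*-identityˡ 1#)
      where
      power₀ : ∀ m → (quadraticFactor l S.^ m) 0 ≈ 1#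
      power₀ zero    = refl
      power₀ (suc m) = trans (*-cong (*-identityˡ 1#) (power₀ m)) (*-identityˡ 1#)

    det-reversed≋Q : n ≡ m ℕ.* 2 ℕ.+ 2 × S.determinant reversed ≋ Q
    det-reversed≋Q = eval-determines (det-constant-term reversed λ i j → refl) Q₀≈1
      (degree-det reversed λ i j → degree-linear _ _)
      (degree-· {m ℕ.* 2} {2} (degree-^ {2} {quadraticFactor l} m (degree-quadraticFactor l)) (degree-quadraticFactor μ))
      eval-det-reversed

    order≡ : n ≡ m ℕ.* 2 ℕ.+ 2
    order≡ = proj₁ det-reversed≋Q

    pair : Carrier → Series
    pair a = geometric a ⊕ geometric (- a)

    PowerSums-quadraticFactor : ∀ a → PowerSums (2 S.× constant 1#) (quadraticFactor a) (pair a)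
    PowerSums-quadraticFactor a = S.trans
      (S.*-congʳ {quadraticFactor a} (S.+-congˡ {constant 1#} (S.+-identityʳ (constant 1#))))
      (PowerSums-· (PowerSums-linear a) (PowerSums-linear (- a)))

    PowerSums-Q : PowerSums (n S.× constant 1#) Q (m S.× pair l ⊕ pair μ)
    PowerSums-Q = S.trans (S.*-congʳ {Q} degrees)
      (PowerSums-· (PowerSums-^ m (PowerSums-quadraticFactor l)) (PowerSums-quadraticFactor μ))
      where
      degrees : n S.× constant 1# ≋ (m S.× (2 S.× constant 1#)) ⊕ (2 S.× constant 1#)
      degrees = S.trans (S.reflexive (≡.cong (S._× constant 1#) order≡))
        (S.trans (S.×-homo-+ (constant 1#) (m ℕ.* 2) 2) (S.+-congʳ (S.sym (S.×-assocˡ (constant 1#) m 2))))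

    -- Both sides satisfy Newton's identity for the same polynomial Q and the same n; subtracting E
    -- Q and cancelling Q leaves them equal.
    trace≋ : trace ≋ m S.× pair l ⊕ pair μ
    trace≋ = ·-cancelˡ Q _ _ Q₀≈1 (S.trans
      (S.sym (S.*-congʳ {trace} P≋Q)) (+ᴱ-cancel (S.trans (S.sym PowerSums-trace) (S.trans (S.*-congˡ {n S.× constant 1#} P≋Q)
        (S.trans PowerSums-Q (S.+-congʳ (coeffs λ k → E-cong k)))))))
      where
      P≋Q = proj₂ det-reversed≋Q
      E-cong : ∀ k → E Q k ≈ E (S.determinant reversed) k
      E-cong k = ×-congʳ k (sym (coeff P≋Q k))
      +ᴱ-cancel : ∀ {f g h} → f ⊕ g ≋ f ⊕ h → g ≋ h
      +ᴱ-cancel {f} {g} {h} eq = coeffs λ k → +-cancelˡ (f k) (g k) (h k) (coeff eq k)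
    
    M : Carrier
    M = m ×′ 1#

    trace-formula : ∀ k → trace k ≈ M * pair l k + pair μ k
    trace-formula k = trans (coeff trace≋ k) (+-congʳ (coeff-× m (pair l) k))

    a b θ : Carrier
    a = l * l + μ * μ
    b = l * l * (μ * μ)
    θ = l * l - μ * μ

    -- Each of ± l and ± μ is a root of z⁴ - a z² + b, so each of the four geometric sequences
    -- satisfies the recurrence.
    trace-recurrence : ∀ k → quadratic a b (trace (4 ℕ.+ k)) (trace (2 ℕ.+ k)) (trace k) ≈ 0#
    trace-recurrence k = trans
      (+-cong (+-cong (trace-formula (4 ℕ.+ k)) (-‿cong (*-congˡ (trace-formula (2 ℕ.+ k))))) (*-congˡ (trace-formula k)))
      -- `g`, `h`, `u`, `v` stand for the k-th powers of l, - l, μ, - μ.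
      (solve 7 (λ l μ m g h u v →
          let x = λ g h → l :* (l :* g) :+ (:- l) :* ((:- l) :* h)
              y = λ u v → μ :* (μ :* u) :+ (:- μ) :* ((:- μ) :* v)
              f = λ p q r s → m :* (p :+ q) :+ (r :+ s)
          in f (l :* (l :* (l :* (l :* g)))) ((:- l) :* ((:- l) :* ((:- l) :* ((:- l) :* h))))
               (μ :* (μ :* (μ :* (μ :* u)))) ((:- μ) :* ((:- μ) :* ((:- μ) :* ((:- μ) :* v))))
             :- (l :* l :+ μ :* μ) :* (m :* x g h :+ y u v)
             :+ l :* l :* (μ :* μ) :* f g h u v
             := con (+ 0))
        refl l μ M _ _ _ _)

    trace₂ : trace 2 ≈ M * (l * l + l * l) + (μ * μ + μ * μ)
    trace₂ = trans (trace-formula 2) (trans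
      (solve 4 (λ l μ m e → m :* (l :* (l :* e) :+ (:- l) :* ((:- l) :* e)) :+ (μ :* (μ :* e) :+ (:- μ) :* ((:- μ) :* e))
          := (m :* (l :* l :+ l :* l) :+ (μ :* μ :+ μ :* μ)) :* e) refl l μ M 1#)
      (*-identityʳ _))

    X≈0 : ∀ i j → X a b i j ≈ 0#
    X≈0 i j = x*x≈0⇒x≈0 (sum-nonneg-0 (λ j → 0≤x*x (X a b i j))
      (inj₂ (trans (sym -0#≈0#) (-‿cong (sym (rows i))))) j)
      where
      rows : ∀ i → sum (λ j → X a b i j * X a b i j) ≈ 0#
      rows = sum-nonneg-0 (λ i → sum-nonneg λ j → 0≤x*x (X a b i j))
        (inj₂ (trans (sym -0#≈0#) (-‿cong (sym (X-isotropic a b trace-recurrence)))))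

    B : Matrix n
    B i j = l * l * δ i j - power 2 i j

    -- (l² - A²)² = (l² - A²)(μ² - A²) + θ (l² - A²), and the first summand is X = 0. As B is
    -- symmetric, B² is written with inner products of rows, the form in which sums of squares
    -- arise.
    B-idempotent : ∀ i j → sum (λ k → B i k * B j k) ≈ θ * B i j
    B-idempotent i j = let open ≈-Reasoning in begin
      sum (λ k → B i k * B j k)
        ≈⟨ sum-cong (λ k → solve 5 (λ p d e s t → (p :* d :- s) :* (p :* e :- t)
             := s :* t :+ (((:- p) :* s) :* e :+ d :* (p :* (p :* e) :- p :* t))) refl (l * l) (δ i k) (δ j k) (power 2 i k) (power 2 j k)) ⟩
      sum (λ k → power 2 i k * power 2 j k + (- (l * l) * power 2 i k * δ j k + δ i k * (l * l * (l * l * δ j k) - l * l * power 2 j k)))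
        ≈⟨ trans (sum-+ _ _) (+-cong (trans (sum-cong λ k → *-congˡ (power-sym 2 j k)) (sym (power-+ 2 2 i j)))
             (trans (sum-+ _ _) (+-cong (trans (sum-cong λ k → *-congˡ (δ-sym j k)) (sum-δ _ j))
               (trans (sum-δˡ _ i) (+-cong (*-congˡ (*-congˡ (δ-sym j i))) (-‿cong (*-congˡ (power-sym 2 j i)))))))) ⟩
      power 4 i j + (- (l * l) * power 2 i j + (l * l * (l * l * δ i j) - l * l * power 2 i j))
        ≈⟨ solve 5 (λ p q d s f → f :+ ((:- p) :* s :+ (p :* (p :* d) :- p :* s))
             := (f :- (p :+ q) :* s :+ p :* q :* d) :+ (p :- q) :* (p :* d :- s)) refl (l * l) (μ * μ) (δ i j) (power 2 i j) (power 4 i j) ⟩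
      X a b i j + θ * B i j
        ≈⟨ trans (+-congʳ (X≈0 i j)) (+-identityˡ _) ⟩
      θ * B i j ∎

-- Signed graphs

countF≢0 : ∀ {n} (p : Fin n → Bool) i → p i ≡ true → countF p ≢ 0
countF≢0 p zero    pi eq with true ← p zero = contradiction eq λ ()
countF≢0 p (suc i) pi eq = countF≢0 (p ∘ suc) i pi (ℕ.m+n≡0⇒n≡0 (if p zero then 1 else 0) eq)

distinct-vertices : ∀ {n} → 2 ℕ.≤ n → ∃ λ (i : Fin n) → ∃ λ j → i ≢ j
distinct-vertices (s≤s (s≤s _)) = zero , suc zero , λ ()

module AdjacencyMatrix {c ℓ₁ ℓ₂} (F : OrderedField c ℓ₁ ℓ₂) {n} (Gs : SignedGraph n) where
  open OrderedField F hiding (zero)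
  open IsStrictTotalOrder isStrictTotalOrder using (<-respʳ-≈) renaming (trans to <-trans)
  open IntegerSolver commutativeRing
  open Determinant commutativeRing
  open PowerSeries commutativeRing
  open OrderedFieldProperties F
  open Algebra.Properties.Semiring.Mult semiring using (×-homo-+; ×1-homo-*) renaming (_×_ to _×′_)
  open Algebra.Properties.Ring ring using (-0#≈0#; -1*x≈-x; -‿involutive)
  open SignedGraph Gs
  private module ≈-Reasoning = Relation.Binary.Reasoning.Setoid setoid

  -- Entries of A and A²

  A : Matrix n
  A i j = ιℤ F (adjMatrix Gs i j)

  open TraceFormula A

  two : Carrier
  two = 1# + 1#

  two* : ∀ x → two * x ≈ x + x
  two* x = trans (distribʳ x 1# 1#) (+-cong (*-identityˡ x) (*-identityˡ x))

  [_] : Bool → Carrier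
  [ b ] = if b then 1# else 0#

  []-∧ : ∀ x y → [ x ∧ y ] ≈ [ x ] * [ y ]
  []-∧ true  y = sym (*-identityˡ _)
  []-∧ false y = sym (zeroˡ _)

  countF≈sum : ∀ {n} (p : Fin n → Bool) → countF p ×′ 1# ≈ sum (λ i → [ p i ])
  countF≈sum {zero}  p = sym (sum-zero _)
  countF≈sum {suc n} p = trans (head (p zero)) (sym (sum-suc _))
    where
    head : ∀ b → ((if b then 1 else 0) ℕ.+ countF (p ∘ suc)) ×′ 1# ≈ [ b ] + sum (λ i → [ p (suc i) ])
    head true  = +-congˡ (countF≈sum (p ∘ suc))
    head false = trans (countF≈sum (p ∘ suc)) (sym (+-identityˡ _))

  sum-const≈ : ∀ n x → sum {n} (λ _ → x) ≈ (n ×′ 1#) * x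
  sum-const≈ zero    x = trans (sum-zero _) (sym (zeroˡ x))
  sum-const≈ (suc n) x = trans (sum-suc _) (trans (+-cong (sym (*-identityˡ x)) (sum-const≈ n x)) (sym (distribʳ x 1# (n ×′ 1#))))

  -- s and t count the selected terms equal to 1 and to -1. Keeping both ties the signed value of an
  -- entry of A² to the unsigned number of common neighbours.
  signed-sum : ∀ {n} (p : Fin n → Bool) (f : Fin n → Carrier) →
    (∀ i → p i ≡ false → f i ≈ 0#) → (∀ i → p i ≡ true → f i ≈ 1# ⊎ f i ≈ - 1#) →
    ∃ λ s → ∃ λ t → s ℕ.+ t ≡ countF p × sum f ≈ s ×′ 1# - t ×′ 1#
  signed-sum {zero}  p f f≈0 f≈±1 = 0 , 0 , ≡.refl , trans (sum-zero f) (sym (-‿inverseʳ 0#))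
  signed-sum {suc n} p f f≈0 f≈±1
    with s , t , s+t≡ , eq ← signed-sum (p ∘ suc) (f ∘ suc) (f≈0 ∘ suc) (f≈±1 ∘ suc)
    with p zero in p₀
  ... | false = s , t , s+t≡ , trans (sum-suc f) (trans (+-cong (f≈0 zero p₀) eq) (+-identityˡ _))
  ... | true with f≈±1 zero p₀
  ...   | inj₁ f₀≈1  = suc s , t , ≡.cong suc s+t≡ ,
    trans (sum-suc f) (trans (+-cong f₀≈1 eq) (sym (+-assoc 1# _ _)))
  ...   | inj₂ f₀≈-1 = s , suc t , ≡.trans (ℕ.+-suc s t) (≡.cong suc s+t≡) ,
    trans (sum-suc f) (trans (+-cong f₀≈-1 eq) (solve 3 (λ o s t → :- o :+ (s :- t) := s :- (o :+ t)) refl 1# (s ×′ 1#) (t ×′ 1#)))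

  A-non-edge : ∀ i j → adj i j ≡ false → A i j ≈ 0#
  A-non-edge i j e rewrite e = refl

  A-edge : ∀ i j → adj i j ≡ true → A i j ≈ 1# ⊎ A i j ≈ - 1#
  A-edge i j e rewrite e with neg i j
  ... | true  = inj₂ (-‿cong (+-identityʳ 1#))
  ... | false = inj₁ (+-identityʳ 1#)

  A-sym : ∀ i j → A i j ≈ A j i
  A-sym i j with adj i j in e
  ... | false = sym (A-non-edge j i (≡.trans (adj-sym j i) e))
  ... | true rewrite ≡.trans (adj-sym j i) e | neg-sym i j e = refl

  A² : Matrix n
  A² = power 2

  A²≈ : ∀ i j → A² i j ≈ sum (λ k → A i k * A j k)
  A²≈ i j = sum-cong λ k → *-cong (power-1 i k) (A-sym k j)

  degree : Fin n → Carrier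
  degree i = sum (λ k → [ adj i k ])

  A²-diagonal : ∀ i → A² i i ≈ degree i
  A²-diagonal i = trans (A²≈ i i) (sum-cong entry)
    where
    entry : ∀ k → A i k * A i k ≈ [ adj i k ]
    entry k with adj i k in e
    ... | false = zeroˡ _
    ... | true with neg i k
    ...   | true  = trans (*-cong (-‿cong (+-identityʳ 1#)) (-‿cong (+-identityʳ 1#)))
                      (trans (solve 1 (λ x → (:- x) :* (:- x) := x :* x) refl 1#) (*-identityˡ 1#))
    ...   | false = trans (*-cong (+-identityʳ 1#) (+-identityʳ 1#)) (*-identityˡ 1#)

  A²-signed : ∀ i j → ∃ λ s → ∃ λ t → s ℕ.+ t ≡ commonNbrs Gs i j × A² i j ≈ s ×′ 1# - t ×′ 1#
  A²-signed i j =
    let s , t , s+t≡ , eq = signed-sum (λ k → adj i k ∧ adj j k) (λ k → A i k * A j k) not-common common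
    in s , t , s+t≡ , trans (A²≈ i j) eq
    where
    not-common : ∀ k → adj i k ∧ adj j k ≡ false → A i k * A j k ≈ 0#
    not-common k e with adj i k in eᵢ
    ... | false = zeroˡ _
    ... | true  = trans (*-congˡ (A-non-edge j k e)) (zeroʳ _)
    common : ∀ k → adj i k ∧ adj j k ≡ true → A i k * A j k ≈ 1# ⊎ A i k * A j k ≈ - 1#
    common k e with adj i k in eᵢ | A-edge i k
    ... | true | edgeᵢ with edgeᵢ ≡.refl | A-edge j k e
    ...   | inj₁ p | inj₁ q = inj₁ (trans (*-cong p q) (*-identityˡ 1#))
    ...   | inj₁ p | inj₂ q = inj₂ (trans (*-cong p q) (*-identityˡ _))
    ...   | inj₂ p | inj₁ q = inj₂ (trans (*-cong p q) (*-identityʳ _))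
    ...   | inj₂ p | inj₂ q = inj₁ (trans (*-cong p q) (trans (solve 1 (λ x → (:- x) :* (:- x) := x :* x) refl 1#) (*-identityˡ 1#)))

  -- The two walks through two common neighbours either have the same sign or cancel: s + t = 2
  -- leaves only 2, 0 and -2 for s - t.
  A²-off-diagonal : ∀ i j → commonNbrs Gs i j ≡ 0 ⊎ commonNbrs Gs i j ≡ 2 →
    A² i j ≈ 0# ⊎ A² i j ≈ two ⊎ A² i j ≈ - two
  A²-off-diagonal i j c∈0,2 with A²-signed i j
  ... | s , t , s+t≡c , eq with c∈0,2
  ...   | inj₁ c≡0 with ≡.refl ← ℕ.m+n≡0⇒m≡0 s (≡.trans s+t≡c c≡0)
                      | ≡.refl ← ℕ.m+n≡0⇒n≡0 s (≡.trans s+t≡c c≡0) = inj₁ (trans eq (-‿inverseʳ 0#))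
  ...   | inj₂ c≡2 = split s t (≡.trans s+t≡c c≡2) eq
    where
    two≈ : 2 ×′ 1# ≈ two
    two≈ = +-congˡ (+-identityʳ 1#)
    split : ∀ s t → s ℕ.+ t ≡ 2 → A² i j ≈ s ×′ 1# - t ×′ 1# → A² i j ≈ 0# ⊎ A² i j ≈ two ⊎ A² i j ≈ - two
    split 0 t ≡.refl eq = inj₂ (inj₂ (trans eq (trans (+-identityˡ _) (-‿cong two≈))))
    split 1 t ≡.refl eq = inj₁ (trans eq (-‿inverseʳ _))
    split 2 t ≡.refl eq = inj₂ (inj₁ (trans eq (trans (+-congˡ -0#≈0#) (trans (+-identityʳ _) two≈))))

  commonNbrs≈sum : ∀ i j → commonNbrs Gs i j ×′ 1# ≈ sum (λ k → [ adj i k ] * [ adj j k ])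
  commonNbrs≈sum i j = trans (countF≈sum (λ k → adj i k ∧ adj j k)) (sum-cong λ k → []-∧ (adj i k) (adj j k))

  commonNbrs-self : ∀ i → commonNbrs Gs i i ×′ 1# ≈ degree i
  commonNbrs-self i = trans (commonNbrs≈sum i i) (sum-cong λ k → idempotent (adj i k))
    where
    idempotent : ∀ b → [ b ] * [ b ] ≈ [ b ]
    idempotent true  = *-identityˡ 1#
    idempotent false = zeroˡ _

  -- Regularity

  module _ (02-property : ∀ i j → i ≢ j → commonNbrs Gs i j ≡ 0 ⊎ commonNbrs Gs i j ≡ 2) where

    -- An entry of the cube of the unsigned adjacency matrix: the number of walks of length three,
    -- grouped by their second vertex.
    walks₃ : Fin n → Fin n → Carrier
    walks₃ u v = sum (λ w → [ adj u w ] * (commonNbrs Gs w v ×′ 1#))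

    walks₃-sym : ∀ u v → walks₃ u v ≈ walks₃ v u
    walks₃-sym u v = let open ≈-Reasoning in begin
      walks₃ u v
        ≈⟨ sum-cong (λ w → trans (*-congˡ (commonNbrs≈sum w v)) (*-sumˡ _ _)) ⟩
      sum (λ w → sum (λ k → [ adj u w ] * ([ adj w k ] * [ adj v k ])))
        ≈⟨ sum-comm _ ⟩
      sum (λ k → sum (λ w → [ adj u w ] * ([ adj w k ] * [ adj v k ])))
        ≈⟨ sum-cong (λ k → sum-cong λ w → trans
             (solve 3 (λ x y z → x :* (y :* z) := z :* (y :* x)) refl [ adj u w ] [ adj w k ] [ adj v k ])
             (*-congˡ (*-congʳ (reflexive (≡.cong [_] (adj-sym w k)))))) ⟩
      sum (λ k → sum (λ w → [ adj v k ] * ([ adj k w ] * [ adj u w ])))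
        ≈⟨ sum-cong (λ k → trans (*-congˡ (commonNbrs≈sum k u)) (*-sumˡ _ _)) ⟨
      walks₃ v u ∎

    -- For an edge uv every neighbour w ≠ v of u shares the neighbour u with v, hence exactly two.
    walks₃-edge : ∀ u v → adj u v ≡ true → walks₃ u v ≈ (degree u + degree u) + (degree v - two)
    walks₃-edge u v uv = let open ≈-Reasoning in begin
      walks₃ u v
        ≈⟨ sum-cong entry ⟩
      sum (λ w → two * [ adj u w ] + (degree v - two) * δ w v)
        ≈⟨ trans (sum-+ _ _) (+-cong (trans (sym (*-sumˡ two _)) (two* (degree u))) (sum-δ (λ _ → degree v - two) v)) ⟩
      (degree u + degree u) + (degree v - two) ∎
      where
      entry : ∀ w → [ adj u w ] * (commonNbrs Gs w v ×′ 1#) ≈ two * [ adj u w ] + (degree v - two) * δ w v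
      entry w with w Fin.≟ v
      ... | yes ≡.refl rewrite uv = trans (*-identityˡ _) (trans (commonNbrs-self w)
        (sym (trans (+-cong (*-identityʳ two) (*-identityʳ _)) (solve 2 (λ t d → t :+ (d :- t) := d) refl two (degree w)))))
      ... | no w≢v with adj u w in uw
      ...   | false = trans (zeroˡ _) (sym (trans (+-cong (zeroʳ two) (zeroʳ _)) (+-identityˡ 0#)))
      ...   | true with 02-property w v w≢v
      ...     | inj₁ c≡0 = contradiction c≡0 (countF≢0 (λ k → adj w k ∧ adj v k) u
                  (≡.cong₂ _∧_ (≡.trans (adj-sym w u) uw) (≡.trans (adj-sym v u) uv)))
      ...     | inj₂ c≡2 rewrite c≡2 = trans (*-identityˡ _) (trans (+-congˡ (+-identityʳ 1#))
                  (sym (trans (+-cong (*-identityʳ two) (zeroʳ _)) (+-identityʳ two))))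

    -- The walks of length three counted from the two ends give 2 deg u + deg v - 2 = 2 deg v + deg
    -- u - 2.
    degree-edge : ∀ u v → adj u v ≡ true → degree u ≈ degree v
    degree-edge u v uv = x-y≈0⇒x≈y (let open ≈-Reasoning in begin
      degree u - degree v
        ≈⟨ solve 3 (λ t p q → p :- q := ((p :+ p) :+ (q :- t)) :- ((q :+ q) :+ (p :- t))) refl two (degree u) (degree v) ⟩
      ((degree u + degree u) + (degree v - two)) - ((degree v + degree v) + (degree u - two))
        ≈⟨ +-cong (walks₃-edge u v uv) (-‿cong (walks₃-edge v u (≡.trans (adj-sym v u) uv))) ⟨
      walks₃ u v - walks₃ v u
        ≈⟨ +-congʳ (walks₃-sym u v) ⟩
      walks₃ v u - walks₃ v u
        ≈⟨ -‿inverseʳ _ ⟩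
      0# ∎)

    regular : Connected Gs → ∀ i j → degree i ≈ degree j
    regular connected i j = along (connected i j)
      where
      along : ∀ {i j} → Walk Gs i j → degree i ≈ degree j
      along here         = refl
      along (step ij jk) = trans (degree-edge _ _ ij) (along jk)

    -- The spectrum forces completeness

    module Extremal (connected : Connected Gs) (m : ℕ) (1≤m : m ≥ 1) (l μ : Carrier) (1≤μ : 1# ≤ μ) (μ<l : μ < l)
      (charPoly : ∀ x → charPolyAt F (adjMatrix Gs) x ≈ pow F (x * x - l * l) m * (x * x - μ * μ))
      (i₀ j₀ : Fin n) (i₀≢j₀ : i₀ ≢ j₀)
      where
      open Spectrum A A-sym m l μ charPoly

      r d : Carrier
      r = degree i₀
      d = l * l - r

      order≈ : n ×′ 1# ≈ M * two + two
      order≈ = let open ≈-Reasoning in begin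
        n ×′ 1#                         ≡⟨ ≡.cong (_×′ 1#) order≡ ⟩
        (m ℕ.* 2 ℕ.+ 2) ×′ 1#           ≈⟨ ×-homo-+ 1# (m ℕ.* 2) 2 ⟩
        (m ℕ.* 2) ×′ 1# + 2 ×′ 1#       ≈⟨ +-congʳ (×1-homo-* m 2) ⟩
        M * (2 ×′ 1#) + 2 ×′ 1#         ≈⟨ +-cong (*-congˡ (+-congˡ (+-identityʳ 1#))) (+-congˡ (+-identityʳ 1#)) ⟩
        M * two + two                   ∎

      0<μ : 0# < μ
      0<μ = 1≤x⇒0<x 1≤μ

      0<θ : 0# < θ
      0<θ = <-respʳ-≈ (solve 2 (λ l μ → (l :- μ) :* (l :+ μ) := l :* l :- μ :* μ) refl l μ)
        (*-pos (x<y⇒0<y-x μ<l) (0<x+y (<-trans 0<μ μ<l) (inj₁ 0<μ)))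

      0<M : 0# < M
      0<M = 0<×1 1≤m

      0<two : 0# < two
      0<two = 0<x+y 0<1 (inj₁ 0<1)

      -- The trace of A² computed twice gives (2m + 2) r = 2m l² + 2μ². The proof works with the
      -- doubled difference and cancels `two` at the end.
      degree-balance : r ≈ M * d + μ * μ
      degree-balance = x-y≈0⇒x≈y (*-cancel-0 (0<x⇒x≉0 0<two) (let open ≈-Reasoning in begin
        two * (r - (M * d + μ * μ))
          ≈⟨ two* _ ⟩
        (r - (M * d + μ * μ)) + (r - (M * d + μ * μ))
          ≈⟨ solve 4 (λ r m l μ → let x = r :- (m :* (l :* l :- r) :+ μ :* μ) in
               x :+ x := (m :* (r :+ r) :+ (r :+ r)) :- (m :* (l :* l :+ l :* l) :+ (μ :* μ :+ μ :* μ))) refl r M l μ ⟩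
        (M * (r + r) + (r + r)) - (M * (l * l + l * l) + (μ * μ + μ * μ))
          ≈⟨ +-cong (+-cong (*-congˡ (two* r)) (two* r)) (-‿cong trace₂) ⟨
        (M * (two * r) + two * r) - trace 2
          ≈⟨ +-congʳ (solve 3 (λ m t r → m :* (t :* r) :+ t :* r := (m :* t :+ t) :* r) refl M two r) ⟩
        (M * two + two) * r - trace 2
          ≈⟨ +-congʳ (*-congʳ order≈) ⟨
        (n ×′ 1#) * r - trace 2
          ≈⟨ +-cong (sym (sum-const≈ n r)) (-‿cong (sum-cong λ i → trans (A²-diagonal i) (regular connected i i₀))) ⟩
        sum {n} (λ _ → r) - sum {n} (λ _ → r)
          ≈⟨ -‿inverseʳ _ ⟩
        0# ∎))

      δ-diagonal : ∀ i → δ {n} i i ≈ 1#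
      δ-diagonal i with i Fin.≟ i
      ... | yes _  = refl
      ... | no i≢i = contradiction ≡.refl i≢i

      δ-off-diagonal : ∀ {i j} → i ≢ j → δ {n} i j ≈ 0#
      δ-off-diagonal {i} {j} i≢j with i Fin.≟ j
      ... | yes i≡j = contradiction i≡j i≢j
      ... | no _    = refl

      B-diagonal : ∀ i → B i i ≈ d
      B-diagonal i = +-cong (trans (*-congˡ (δ-diagonal i)) (*-identityʳ _))
        (-‿cong (trans (A²-diagonal i) (regular connected i i₀)))

      B-off-diagonal : ∀ {i j} → i ≢ j → B i j ≈ - A² i j
      B-off-diagonal i≢j = trans (+-congʳ (trans (*-congˡ (δ-off-diagonal i≢j)) (zeroʳ _))) (+-identityˡ _)

      -- θB = B² makes B positive semidefinite; this is the quadratic form at eᵢ + s eⱼ.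
      B-semidefinite : ∀ i j s → s * s ≈ 1# → 0# ≤ (θ * ((d + d) + (s * B i j + s * B i j)))
      B-semidefinite i j s ss≈1 = ≤-respʳ-≈ (let open ≈-Reasoning in begin
        sum (λ k → (B i k + s * B j k) * (B i k + s * B j k))
          ≈⟨ sum-cong (λ k → solve 3 (λ s x y → (x :+ s :* y) :* (x :+ s :* y) := x :* x :+ (s :* s :* (y :* y) :+ (s :+ s) :* (x :* y))) refl s (B i k) (B j k)) ⟩
        sum (λ k → B i k * B i k + (s * s * (B j k * B j k) + (s + s) * (B i k * B j k)))
          ≈⟨ trans (sum-+ _ _) (+-cong (square i) (trans (sum-+ _ _) (+-cong
               (trans (sym (*-sumˡ (s * s) _)) (trans (*-cong ss≈1 (square j)) (*-identityˡ _)))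
               (trans (sym (*-sumˡ (s + s) _)) (*-congˡ (B-idempotent i j)))))) ⟩
        θ * d + (θ * d + (s + s) * (θ * B i j))
          ≈⟨ solve 4 (λ t d s b → t :* d :+ (t :* d :+ (s :+ s) :* (t :* b)) := t :* ((d :+ d) :+ (s :* b :+ s :* b))) refl θ d s (B i j) ⟩
        θ * ((d + d) + (s * B i j + s * B i j)) ∎)
        (sum-nonneg λ k → 0≤x*x (B i k + s * B j k))
        where
        square : ∀ i → sum (λ k → B i k * B i k) ≈ θ * d
        square i = trans (B-idempotent i i) (*-congˡ (B-diagonal i))

      -- If the entry is ± 2, a sign s with s `B i j` = -2 gives the semidefinite form the value 2 θ
      -- (d - 2) < 0.
      d<2⇒A²-off-diagonal≈0 : (d - two) < 0# → ∀ {i j} → i ≢ j → A² i j ≈ 0#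
      d<2⇒A²-off-diagonal≈0 d<2 {i} {j} i≢j with A²-off-diagonal i j (02-property i j i≢j)
      ... | inj₁ A²≈0 = A²≈0
      ... | inj₂ A²≈±2 = contradiction (≤-respʳ-≈ negative (B-semidefinite i j s ss≈1)) (0<x⇒0≰-x
              (*-pos 0<θ (0<x+y (x<0⇒0<-x d<2) (inj₁ (x<0⇒0<-x d<2)))))
        where
        sign : A² i j ≈ two ⊎ A² i j ≈ - two → ∃ λ s → s * s ≈ 1# × s * B i j ≈ - two
        sign (inj₁ A²≈2)  = 1# , *-identityˡ 1# , trans (*-identityˡ _) (trans (B-off-diagonal i≢j) (-‿cong A²≈2))
        sign (inj₂ A²≈-2) = - 1# , trans (-1*x≈-x (- 1#)) (-‿involutive 1#) ,
          trans (-1*x≈-x _) (-‿cong (trans (B-off-diagonal i≢j) (trans (-‿cong A²≈-2) (-‿involutive two))))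
        s = proj₁ (sign A²≈±2)
        ss≈1 = proj₁ (proj₂ (sign A²≈±2))
        sB≈-2 = proj₂ (proj₂ (sign A²≈±2))
        negative : θ * ((d + d) + (s * B i j + s * B i j)) ≈ - (θ * (- (d - two) + - (d - two)))
        negative = trans (*-congˡ (+-congˡ (+-cong sB≈-2 sB≈-2)))
          (solve 3 (λ t d w → t :* ((d :+ d) :+ (:- w :+ :- w)) := :- (t :* (:- (d :- w) :+ :- (d :- w)))) refl θ d two)

      -- A diagonal entry of B² = θB: only the diagonal term of the row survives, so d² = θ d.
      d<2⇒d[θ-d]≈0 : (d - two) < 0# → d * (θ - d) ≈ 0#
      d<2⇒d[θ-d]≈0 d<2 = let open ≈-Reasoning in begin
        d * (θ - d)
          ≈⟨ solve 2 (λ d t → d :* (t :- d) := t :* d :- d :* d) refl d θ ⟩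
        θ * d - d * d
          ≈⟨ +-congʳ (trans (*-congˡ (sym (B-diagonal i₀))) (sym (B-idempotent i₀ i₀))) ⟩
        sum (λ k → B i₀ k * B i₀ k) - d * d
          ≈⟨ +-congʳ (trans (sum-cong entry) (sum-δˡ (λ _ → d * d) i₀)) ⟩
        d * d - d * d
          ≈⟨ -‿inverseʳ _ ⟩
        0# ∎
        where
        entry : ∀ k → B i₀ k * B i₀ k ≈ δ i₀ k * (d * d)
        entry k = diagonal-or-not (i₀ Fin.≟ k)
          where
          diagonal-or-not : Dec (i₀ ≡ k) → B i₀ k * B i₀ k ≈ δ i₀ k * (d * d)
          diagonal-or-not (yes ≡.refl) = trans (*-cong (B-diagonal i₀) (B-diagonal i₀))
            (sym (trans (*-congʳ (δ-diagonal i₀)) (*-identityˡ _)))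
          diagonal-or-not (no i₀≢k) = trans (*-congˡ (trans (B-off-diagonal i₀≢k)
              (trans (-‿cong (d<2⇒A²-off-diagonal≈0 d<2 i₀≢k)) -0#≈0#)))
            (trans (zeroʳ _) (sym (trans (*-congʳ (δ-off-diagonal i₀≢k)) (zeroˡ _))))

      -- l² cancels in θ - d, leaving r - μ². The relation shows that neither d = 0 nor d = θ is
      -- possible.
      θ-d≈Md : θ - d ≈ M * d
      θ-d≈Md = let open ≈-Reasoning in begin
        θ - d                   ≈⟨ solve 3 (λ p q r → (p :- q) :- (p :- r) := r :- q) refl (l * l) (μ * μ) r ⟩
        r - μ * μ               ≈⟨ +-congʳ degree-balance ⟩
        M * d + μ * μ - μ * μ   ≈⟨ solve 2 (λ x q → x :+ q :- q := x) refl (M * d) (μ * μ) ⟩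
        M * d                   ∎

      d≉0 : ¬ d ≈ 0#
      d≉0 d≈0 = 0<x⇒x≉0 0<θ (let open ≈-Reasoning in begin
        θ             ≈⟨ solve 2 (λ t d → t := (t :- d) :+ d) refl θ d ⟩
        θ - d + d     ≈⟨ +-cong (trans θ-d≈Md (trans (*-congˡ d≈0) (zeroʳ M))) d≈0 ⟩
        0# + 0#       ≈⟨ +-identityˡ 0# ⟩
        0#            ∎)

      0≤d-2 : 0# ≤ (d - two)
      0≤d-2 = ≮0⇒0≤ λ d<2 → d≉0 (*-cancel-0 (0<x⇒x≉0 0<M)
        (trans (sym θ-d≈Md) (*-cancel-0 d≉0 (d<2⇒d[θ-d]≈0 d<2))))

      sum-1-δ : ∀ i → sum (λ k → 1# - δ i k) ≈ n ×′ 1# - 1#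
      sum-1-δ i = trans (sum-+ _ _) (+-cong (trans (sum-const≈ n 1#) (*-identityʳ _))
        (trans (sum-neg _) (-‿cong (trans (sum-cong λ k → sym (*-identityʳ (δ i k))) (sum-δˡ (λ _ → 1#) i)))))

      -- Vertex i has n - 1 - r non-neighbours besides itself. With n = 2m + 2 and r = m d + μ² this
      -- number is - (m (d - 2) + (μ - 1)(μ + 1)), which is at most 0.
      complete : ∀ i j → i ≢ j → adj i j ≡ true
      complete i j i≢j = from-defect (trans
          (+-congʳ (sym (trans (+-congˡ (trans (-‿cong (δ-off-diagonal i≢j)) -0#≈0#)) (+-identityʳ 1#))))
          (sum-nonneg-0 defect-nonneg defect-sum j))
        where
        from-defect : 1# - [ adj i j ] ≈ 0# → adj i j ≡ true
        from-defect eq with adj i j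
        ... | true  = ≡.refl
        ... | false = contradiction (trans (sym (trans (+-congˡ -0#≈0#) (+-identityʳ 1#))) eq) (0<x⇒x≉0 0<1)
        -- The indicator of a vertex that is neither i nor adjacent to i.
        defect : Fin n → Carrier
        defect k = 1# - δ i k - [ adj i k ]
        defect-nonneg : ∀ k → 0# ≤ defect k
        defect-nonneg k with i Fin.≟ k
        ... | yes ≡.refl rewrite adj-irr i = inj₂ (sym (trans (+-cong (-‿inverseʳ 1#) -0#≈0#) (+-identityˡ 0#)))
        ... | no _ with adj i k
        ...   | true  = inj₂ (sym (trans (+-congʳ (trans (+-congˡ -0#≈0#) (+-identityʳ 1#))) (-‿inverseʳ 1#)))
        ...   | false = inj₁ (<-respʳ-≈ (sym (trans (+-cong (trans (+-congˡ -0#≈0#) (+-identityʳ 1#)) -0#≈0#) (+-identityʳ 1#))) 0<1)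
        sum-defect : sum defect ≈ n ×′ 1# - 1# - r
        sum-defect = trans (sum-+ _ _) (+-cong (sum-1-δ i) (trans (sum-neg _) (-‿cong (regular connected i i₀))))
        defect-sum : 0# ≤ (- sum defect)
        defect-sum = ≤-respʳ-≈ (let open ≈-Reasoning in begin
          M * (d - two) + (μ - 1#) * (μ + 1#)
            ≈⟨ +-congˡ (trans (solve 2 (λ u o → (u :- o) :* (u :+ o) := u :* u :- o :* o) refl μ 1#)
                 (+-congˡ (-‿cong (*-identityˡ 1#)))) ⟩
          M * (d - two) + (μ * μ - 1#)
            ≈⟨ solve 4 (λ m d u o → m :* (d :- (o :+ o)) :+ (u :* u :- o)
                 := :- ((m :* (o :+ o) :+ (o :+ o)) :- o :- (m :* d :+ u :* u))) refl M d μ 1# ⟩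
          - (M * two + two - 1# - (M * d + μ * μ))
            ≈⟨ -‿cong (+-cong (+-congʳ order≈) (-‿cong degree-balance)) ⟨
          - (n ×′ 1# - 1# - r)
            ≈⟨ -‿cong sum-defect ⟨
          - sum defect ∎)
          (0≤x+y (0≤x*y (inj₁ 0<M) 0≤d-2) (0≤x*y (x≤y⇒0≤y-x 1≤μ) (inj₁ (0<x+y 0<μ (inj₁ 0<1)))))

      adj≈1-δ : ∀ i k → [ adj i k ] ≈ 1# - δ i k
      adj≈1-δ i k = by-cases (i Fin.≟ k)
        where
        by-cases : Dec (i ≡ k) → [ adj i k ] ≈ 1# - δ i k
        by-cases (yes ≡.refl) = trans (reflexive (≡.cong [_] (adj-irr i)))
          (sym (trans (+-congˡ (-‿cong (δ-diagonal i))) (-‿inverseʳ 1#)))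
        by-cases (no i≢k) = trans (reflexive (≡.cong [_] (complete i k i≢k)))
          (sym (trans (+-congˡ (trans (-‿cong (δ-off-diagonal i≢k)) -0#≈0#)) (+-identityʳ 1#)))

      -- In a complete graph every third vertex is a common neighbour. The 2 stands on the left so
      -- that the equation descends to ℕ without truncated subtraction.
      commonNbrs+2≈order : ∀ i j → i ≢ j → (2 ℕ.+ commonNbrs Gs i j) ×′ 1# ≈ n ×′ 1#
      commonNbrs+2≈order i j i≢j = trans (+-congˡ (+-congˡ sum-common))
        (solve 2 (λ o n → o :+ (o :+ ((n :- o) :- o)) := n) refl 1# (n ×′ 1#))
        where
        common : ∀ k → [ adj i k ] * [ adj j k ] ≈ (1# - δ i k) + - ((1# - δ i k) * δ k j)
        common k = let open ≈-Reasoning in begin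
          [ adj i k ] * [ adj j k ]
            ≈⟨ *-cong (adj≈1-δ i k) (trans (adj≈1-δ j k) (+-congˡ (-‿cong (δ-sym j k)))) ⟩
          (1# - δ i k) * (1# - δ k j)
            ≈⟨ solve 3 (λ x y o → x :* (o :- y) := x :* o :- x :* y) refl (1# - δ i k) (δ k j) 1# ⟩
          (1# - δ i k) * 1# - (1# - δ i k) * δ k j
            ≈⟨ +-congʳ (*-identityʳ _) ⟩
          (1# - δ i k) - (1# - δ i k) * δ k j ∎
        sum-common : commonNbrs Gs i j ×′ 1# ≈ (n ×′ 1# - 1#) - 1#
        sum-common = let open ≈-Reasoning in begin
          commonNbrs Gs i j ×′ 1#
            ≈⟨ trans (commonNbrs≈sum i j) (sum-cong common) ⟩
          sum (λ k → (1# - δ i k) - (1# - δ i k) * δ k j)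
            ≈⟨ trans (sum-+ _ _) (+-cong (sum-1-δ i) (trans (sum-neg _) (-‿cong (sum-δ (λ k → 1# - δ i k) j)))) ⟩
          (n ×′ 1# - 1#) - (1# - δ i j)
            ≈⟨ +-congˡ (-‿cong (trans (+-congˡ (trans (-‿cong (δ-off-diagonal i≢j)) -0#≈0#)) (+-identityʳ 1#))) ⟩
          (n ×′ 1# - 1#) - 1# ∎

      order≡4 : n ≡ 4
      order≡4 = by-cases (02-property i₀ j₀ i₀≢j₀)
        where
        2+c≡n : 2 ℕ.+ commonNbrs Gs i₀ j₀ ≡ n
        2+c≡n = ×1-injective _ n (commonNbrs+2≈order i₀ j₀ i₀≢j₀)
        by-cases : commonNbrs Gs i₀ j₀ ≡ 0 ⊎ commonNbrs Gs i₀ j₀ ≡ 2 → n ≡ 4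
        by-cases (inj₂ c≡2) = ≡.trans (≡.sym 2+c≡n) (≡.cong (2 ℕ.+_) c≡2)
        -- No common neighbour would mean n = 2, while n = 2m + 2 with m ≥ 1.
        by-cases (inj₁ c≡0) = contradiction
          (ℕ.+-cancelʳ-≡ 2 0 (m ℕ.* 2) (≡.trans (≡.cong (2 ℕ.+_) (≡.sym c≡0)) (≡.trans 2+c≡n order≡)))
          (ℕ.<⇒≢ (ℕ.*-mono-≤ 1≤m (s≤s (z≤n {1}))))

theorem6p3 : ∀ {c ℓ₁ ℓ₂} (F : OrderedField c ℓ₁ ℓ₂) {n : ℕ} (Gs : SignedGraph n)
    (m : ℕ) (λ′ μ : OrderedField.Carrier F) →
    Is02 Gs →
    m ≥ 1 →
    OrderedField._≤_ F (OrderedField.1# F) μ →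
    OrderedField._<_ F μ λ′ →
    (∀ x → OrderedField._≈_ F (charPolyAt F (adjMatrix Gs) x)
    (OrderedField._*_ F
    (pow F (OrderedField._-_ F (OrderedField._*_ F x x) (OrderedField._*_ F λ′ λ′)) m)
    (OrderedField._-_ F (OrderedField._*_ F x x) (OrderedField._*_ F μ μ)))) →
    IsK4 Gs
theorem6p3 F {n} Gs m λ′ μ (connected , 02-property) 1≤m 1≤μ μ<λ′ charPoly =
  let open AdjacencyMatrix F Gs
      -- The order is extracted first: n ≥ 2 supplies the two distinct vertices that `Extremal`
      -- takes as parameters.
      order≡ = OrderedFieldProperties.Spectrum.order≡ F A A-sym m λ′ μ charPoly
      i , j , i≢j = distinct-vertices (≡.subst (2 ℕ.≤_) (≡.sym order≡) (ℕ.m≤n+m 2 (m ℕ.* 2)))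
      open Extremal 02-property connected m 1≤m λ′ μ 1≤μ μ<λ′ charPoly i j i≢j
  in order≡4 , complete
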